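{- Let $(X,d)$ be a compact metric space with binary entropy $\eta$ and relative binary entropies $\eta_m$ ($m\in\mathbb N$), and let $(n_k)_{k\in\mathbb N}$ be a strictly increasing sequence of positive integers. Put $n_{ -1}:=-\infty$ and define $\mu:\mathbb N\to\mathbb N$ by $$\mu(n):=\eta(1+n_0)+\sum_{k=0}^{K}\eta_{n_k}(1+n_{k+1})\qquad\text{for } n_{K-1}<n\le n_K .$$ (i) Suppose there is $c\in\mathbb N$ such that $n_{k+1}\le c+c\cdot n_k$ for all $k$ and $\mu(n_K)\le\eta(c+c\cdot n_K)$ for all $K$. Then $X$ admits a linearly standard representation $\xi:\subseteq\mathcal C\twoheadrightarrow X$ with modulus of continuity $\mu$. (ii) Suppose there is $c\in\mathbb N$ such that $n_{k+1}\le c+c\cdot n_k^{\,c}$ for all $k$ and $\mu(n_K)\le\eta(c+c\cdot n_K^{\,c})$ for all $K$. Then $X$ admits a polynomially standard representation $\xi:\subseteq\mathcal C\twoheadrightarrow X$ with modulus of continuity $\mu$.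
   Context: $\mathbb N=\{0,1,2,\dots\}$. Cantor space $\mathcal C=\{0,1\}^{\mathbb N}$ carries the metric $D(\bar u,\bar v)=2^{ -\min\{n:u_n\neq v_n\}}$ for $\bar u\ne\bar v$, and $D(\bar u,\bar u)=0$. Modulus: a modulus of continuity of $f:(X,d)\to(Y,e)$ is a non-decreasing $\mu:\mathbb N\to\mathbb N$ such that for all $n$ and all $x,x'$: $d(x,x')\le2^{ -\mu(n)}$ implies $e(f(x),f(x'))\le2^{ -n}$. For a partial map, $x,x'$ range over its domain (a metric subspace). The minimal modulus is the pointwise least one. Entropy: the unary entropy $\hat\eta_X(n)$ of a compact metric space $X$ is the least number of closed balls of radius $2^{ -n}$ with centers in $X$ that cover $X$; the binary entropy is $\eta_X(n)=\lceil\log_2\hat\eta_X(n)\rceil$ (written $\eta$). The relative unary entropy is $\hat\eta_m(n)=\sup_{x\in X}\hat\eta_{\overline B(x,2^{ -m})}(n)$, where $\overline B(x,r)=\{x':d(x,x')\le r\}$ is regarded as a metric subspace; the relative binary entropy is $\eta_m(n)=\lceil\log_2\hat\eta_m(n)\rceil$. Representation: a surjective partial map $\xi:\subseteq\mathcal C\twoheadrightarrow X$. The induced semi-metric is $d_\xi(x,x')=\min\{D(u,u'):\xi(u)=x,\ \xi(u')=x'\}$. Reductions: let $\xi,\xi':\subseteq\mathcal C\to X$ be partial maps (not necessarily surjective) with minimal moduli of continuity $\mu_\xi,\mu_{\xi'}$. A polynomial (resp. linear) reduction from $\xi'$ to $\xi$ is a map $G:\mathrm{dom}(\xi')\to\mathrm{dom}(\xi)$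 with a modulus of continuity $\nu$ such that $\xi'(u)=\xi(G(u))$ for all $u\in\mathrm{dom}(\xi')$ and, for some $c\in\mathbb N$ and all $n$, $\nu(\mu_\xi(n))\le\mu_{\xi'}(c+c\,n^c)$ (resp. $\nu(\mu_\xi(n))\le\mu_{\xi'}(c+c\,n)$). A representation $\xi:\subseteq\mathcal C\twoheadrightarrow X$ with minimal modulus $\mu_\xi$ is polynomially standard if: (1) for some $c$ and all $n$, $\mu_\xi(n)\le\eta(c+c\,n^c)$; (2') every (not necessarily surjective) partial $\xi':\subseteq\mathcal C\to X$ possessing a modulus of continuity has a polynomial reduction to $\xi$; and (3) there is a polynomial $p$ with natural-number coefficients such that for all $n$ and $x,x'\in X$, $d(x,x')\le2^{ -p(n)}$ implies $d_\xi(x,x')\le2^{ -\eta(n)}$. It is linearly standard if the same holds with $c+c\,n$ in place of $c+c\,n^c$, linear in place of polynomial reductions, and $p(n)$ of the form $c+c\,n$. -}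

module Defs where

open import Level using (0ℓ)
open import Data.Bool.Base using (Bool)
import Data.Bool.Properties as Bool
open import Data.Fin.Base using (Fin)
open import Data.List.Base using (List; foldr; sum; applyUpTo)
open import Data.List.Relation.Unary.Any using (Any)
open import Data.Nat.Base as ℕ using (ℕ; zero; suc; z≤n; s≤s)
import Data.Nat.Properties as ℕ
open import Data.Nat.Logarithm using (⌈log₂_⌉)
open import Data.Product.Base using (Σ; ∃; ∃-syntax; _×_; _,_; proj₁; proj₂)
open import Data.Rational.Base as ℚ using (ℚ; 0ℚ; 1ℚ; ½)
import Data.Rational.Properties as ℚ
open import Data.Unit.Base using (⊤)
open import Function.Base using (_∘_; _on_)
open import Function.Bundles using (Func)
open import Function.Definitions using (Surjective)
open import Function.Metric.Structures using (IsGeneralMetric)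
open import Relation.Binary.Bundles using (Setoid)
open import Relation.Binary.Core using (Rel)
open import Relation.Binary.Definitions using (Reflexive; Transitive; _Respects_)
open import Relation.Binary.PropositionalEquality
  using (_≡_; _≢_; _≗_; refl; sym; trans; cong; subst)
open import Relation.Binary.Structures using (IsEquivalence; IsPartialOrder)
open import Relation.Nullary.Decidable using (yes; no; toWitnessFalse)
open import Relation.Nullary.Negation using (contradiction)
open import Relation.Unary using (Pred; _∈_)

½^_ : ℕ → ℚ
½^ zero  = 1ℚ
½^ suc n = ½ ℚ.* ½^ n

half-mono : ∀ {p q} → p ℚ.≤ q → ½ ℚ.* p ℚ.≤ ½ ℚ.* q
half-mono = ℚ.*-monoˡ-≤-nonNeg ½

half+half : ∀ p → ½ ℚ.* p ℚ.+ ½ ℚ.* p ≡ p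
half+half p = trans (sym (ℚ.*-distribʳ-+ p ½ ½)) (ℚ.*-identityˡ p)

0≤½^ : ∀ n → 0ℚ ℚ.≤ ½^ n
0≤½^ zero    = ℚ.nonNegative⁻¹ 1ℚ
0≤½^ (suc n) = subst (ℚ._≤ ½^ suc n) (ℚ.*-zeroʳ ½) (half-mono (0≤½^ n))

p≤p+q : ∀ {p q} → 0ℚ ℚ.≤ q → p ℚ.≤ p ℚ.+ q
p≤p+q {p} {q} 0≤q = subst (ℚ._≤ p ℚ.+ q) (ℚ.+-identityʳ p) (ℚ.+-monoʳ-≤ p 0≤q)

½^-step : ∀ n → ½^ suc n ℚ.≤ ½^ n
½^-step n = subst (½^ suc n ℚ.≤_) (half+half (½^ n)) (p≤p+q (0≤½^ (suc n)))

½^≤1 : ∀ n → ½^ n ℚ.≤ 1ℚ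
½^≤1 zero    = ℚ.≤-refl
½^≤1 (suc n) = ℚ.≤-trans (½^-step n) (½^≤1 n)

½^-anti : ∀ {m n} → m ℕ.≤ n → ½^ n ℚ.≤ ½^ m
½^-anti {n = n} z≤n   = ½^≤1 n
½^-anti (s≤s m≤n)     = half-mono (½^-anti m≤n)

interchange : ∀ a b c d → (a ℚ.+ b) ℚ.+ (c ℚ.+ d) ≡ (a ℚ.+ c) ℚ.+ (b ℚ.+ d)
interchange a b c d = trans (ℚ.+-assoc a b (c ℚ.+ d))
  (trans (cong (a ℚ.+_) (trans (sym (ℚ.+-assoc b c d))
    (trans (cong (ℚ._+ d) (ℚ.+-comm b c)) (ℚ.+-assoc c b d))))
  (sym (ℚ.+-assoc a c (b ℚ.+ d))))

Eventually : Pred ℕ 0ℓ → Set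
Eventually P = ∃[ N ] (∀ n → N ℕ.≤ n → P n)

-- Cauchy sequences of rationals, with setoid equality _≃_.  The Cauchy
-- condition needs no absolute value because m and n range over both orders.
record ℝ : Set where
  field
    seq    : ℕ → ℚ
    cauchy : ∀ k → ∃[ N ] (∀ m n → N ℕ.≤ m → N ℕ.≤ n → seq m ℚ.≤ seq n ℚ.+ ½^ k)

open ℝ

infix  4 _≤_ _<_ _≃_
infixl 6 _+_

_≤_ : Rel ℝ 0ℓ
x ≤ y = ∀ k → Eventually (λ n → seq x n ℚ.≤ seq y n ℚ.+ ½^ k)

_<_ : Rel ℝ 0ℓ
x < y = ∃[ k ] Eventually (λ n → seq x n ℚ.+ ½^ k ℚ.≤ seq y n)

_≃_ : Rel ℝ 0ℓ
x ≃ y = x ≤ y × y ≤ x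

_+_ : ℝ → ℝ → ℝ
seq    (x + y) n = seq x n ℚ.+ seq y n
cauchy (x + y) k with cauchy x (suc k) | cauchy y (suc k)
... | M , p | N , q = M ℕ.⊔ N , λ m n l l′ →
  subst (seq x m ℚ.+ seq y m ℚ.≤_)
    (trans (interchange (seq x n) _ (seq y n) _)
           (cong ((seq x n ℚ.+ seq y n) ℚ.+_) (half+half (½^ k))))
    (ℚ.+-mono-≤ (p m n (ℕ.m⊔n≤o⇒m≤o M N l) (ℕ.m⊔n≤o⇒m≤o M N l′))
                (q m n (ℕ.m⊔n≤o⇒n≤o M N l) (ℕ.m⊔n≤o⇒n≤o M N l′)))

fromℚ : ℚ → ℝ
fromℚ q = record { seq = λ _ → q ; cauchy = λ k → 0 , λ _ _ _ _ → p≤p+q (0≤½^ k) }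

0ℝ : ℝ
0ℝ = fromℚ 0ℚ

2^-_ : ℕ → ℝ
2^- n = fromℚ (½^ n)

≤-pointwise : ∀ {x y} → (∀ n → seq x n ℚ.≤ seq y n) → x ≤ y
≤-pointwise h k = 0 , λ n _ → ℚ.≤-trans (h n) (p≤p+q (0≤½^ k))

≤-refl : Reflexive _≤_
≤-refl {x} = ≤-pointwise {x} {x} (λ _ → ℚ.≤-refl)

≤-trans : Transitive _≤_
≤-trans {x} {y} {z} p q k with p (suc k) | q (suc k)
... | M , p′ | N , q′ = M ℕ.⊔ N , λ n l →
  ℚ.≤-trans (p′ n (ℕ.m⊔n≤o⇒m≤o M N l))
    (subst (seq y n ℚ.+ ½^ suc k ℚ.≤_)
      (trans (ℚ.+-assoc (seq z n) _ _) (cong (seq z n ℚ.+_) (half+half (½^ k))))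
      (ℚ.+-monoˡ-≤ (½^ suc k) (q′ n (ℕ.m⊔n≤o⇒n≤o M N l))))

≃-isEquivalence : IsEquivalence _≃_
≃-isEquivalence = record
  { refl  = λ {x} → ≤-refl {x} , ≤-refl {x}
  ; sym   = λ (p , q) → q , p
  ; trans = λ {x} {y} {z} (p , q) (r , s) → ≤-trans {x} {y} {z} p r , ≤-trans {z} {y} {x} s q
  }

≤-isPartialOrder : IsPartialOrder _≃_ _≤_
≤-isPartialOrder = record
  { isPreorder = record
    { isEquivalence = ≃-isEquivalence
    ; reflexive     = proj₁
    ; trans         = λ {x} {y} {z} → ≤-trans {x} {y} {z}
    }
  ; antisym = _,_
  }

record MetricSpace : Set₁ where
  infix 4 _≈_
  field
    Carrier  : Set
    _≈_      : Rel Carrier 0ℓ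
    d        : Carrier → Carrier → ℝ
    isMetric : IsGeneralMetric _≈_ _≃_ _≤_ 0ℝ _+_ d

  open IsGeneralMetric isMetric public using (≈-isEquivalence)

  setoid : Setoid 0ℓ 0ℓ
  setoid = record { isEquivalence = ≈-isEquivalence }

open MetricSpace using (Carrier; setoid)

Subspace : (X : MetricSpace) → Pred (Carrier X) 0ℓ → MetricSpace
Subspace X P = record
  { Carrier  = Σ X.Carrier P
  ; _≈_      = X._≈_ on proj₁
  ; d        = X.d on proj₁
  ; isMetric = record
    { isSemiMetric = record
      { isQuasiSemiMetric = record
        { isPreMetric = record
          { isProtoMetric = record
            { isPartialOrder  = M.isPartialOrder
            ; ≈-isEquivalence = record { refl = M.EqC.refl ; sym = M.EqC.sym ; trans = M.EqC.trans }
            ; cong            = M.cong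
            ; nonNegative     = M.nonNegative
            }
          ; ≈⇒0 = M.≈⇒0
          }
        ; 0⇒≈ = M.0⇒≈
        }
      ; sym = λ x y → M.sym (proj₁ x) (proj₁ y)
      }
    ; triangle = λ x y z → M.triangle (proj₁ x) (proj₁ y) (proj₁ z)
    }
  }
  where
  module X = MetricSpace X
  module M = IsGeneralMetric X.isMetric

closedBall : (X : MetricSpace) → Carrier X → ℕ → Pred (Carrier X) 0ℓ
closedBall X x m x′ = MetricSpace.d X x x′ ≤ 2^- m

IsOpen : (X : MetricSpace) → Pred (Carrier X) 0ℓ → Set
IsOpen X U = ∀ x → x ∈ U → ∃[ r ] (0ℝ < r × (∀ y → MetricSpace.d X x y < r → y ∈ U))

IsCompact : MetricSpace → Set₁
IsCompact X = (I : Set) (U : I → Pred (Carrier X) 0ℓ) →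
  (∀ i → IsOpen X (U i)) → (∀ x → ∃[ i ] x ∈ U i) →
  Σ (List I) λ is → ∀ x → Any (λ i → x ∈ U i) is

-- The n-th approximation to D u v inspects the first n digits: it is
-- 2⁻ᵏ if u and v first differ at position k < n, and 0 if they agree
-- below n.
Dseq : ℕ → (ℕ → Bool) → (ℕ → Bool) → ℚ
Dseq zero    u v = 0ℚ
Dseq (suc n) u v with u 0 Bool.≟ v 0
... | yes _ = ½ ℚ.* Dseq n (u ∘ suc) (v ∘ suc)
... | no  _ = 1ℚ

0≤Dseq : ∀ n u v → 0ℚ ℚ.≤ Dseq n u v
0≤Dseq zero    u v = ℚ.≤-refl
0≤Dseq (suc n) u v with u 0 Bool.≟ v 0
... | yes _ = subst (ℚ._≤ ½ ℚ.* Dseq n (u ∘ suc) (v ∘ suc)) (ℚ.*-zeroʳ ½)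
                (half-mono (0≤Dseq n (u ∘ suc) (v ∘ suc)))
... | no  _ = ℚ.nonNegative⁻¹ 1ℚ

Dseq≤1 : ∀ n u v → Dseq n u v ℚ.≤ 1ℚ
Dseq≤1 zero    u v = ℚ.nonNegative⁻¹ 1ℚ
Dseq≤1 (suc n) u v with u 0 Bool.≟ v 0
... | yes _ = ℚ.≤-trans (half-mono (Dseq≤1 n (u ∘ suc) (v ∘ suc))) (½^≤1 1)
... | no  _ = ℚ.≤-refl

Dseq-cauchy : ∀ m n u v → Dseq m u v ℚ.≤ Dseq n u v ℚ.+ ½^ n
Dseq-cauchy m zero u v = subst (Dseq m u v ℚ.≤_) (sym (ℚ.+-identityˡ 1ℚ)) (Dseq≤1 m u v)
Dseq-cauchy zero (suc n) u v =
  ℚ.≤-trans (0≤Dseq (suc n) u v) (p≤p+q (0≤½^ (suc n)))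
Dseq-cauchy (suc m) (suc n) u v with u 0 Bool.≟ v 0
... | yes _ = subst (½ ℚ.* Dseq m (u ∘ suc) (v ∘ suc) ℚ.≤_)
                (ℚ.*-distribˡ-+ ½ (Dseq n (u ∘ suc) (v ∘ suc)) (½^ n))
                (half-mono (Dseq-cauchy m n (u ∘ suc) (v ∘ suc)))
... | no  _ = p≤p+q (0≤½^ (suc n))

Dseq-cong : ∀ n {u u′ v v′} → u ≗ u′ → v ≗ v′ → Dseq n u v ≡ Dseq n u′ v′
Dseq-cong zero p q = refl
Dseq-cong (suc n) {u} {u′} {v} {v′} p q with u 0 Bool.≟ v 0 | u′ 0 Bool.≟ v′ 0
... | yes _ | yes _ = cong (½ ℚ.*_) (Dseq-cong n (p ∘ suc) (q ∘ suc))
... | yes e | no ¬e = contradiction (trans (sym (p 0)) (trans e (q 0))) ¬e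
... | no ¬e | yes e = contradiction (trans (p 0) (trans e (sym (q 0)))) ¬e
... | no _  | no _  = refl

Dseq-sym : ∀ n u v → Dseq n u v ≡ Dseq n v u
Dseq-sym zero u v = refl
Dseq-sym (suc n) u v with u 0 Bool.≟ v 0 | v 0 Bool.≟ u 0
... | yes _ | yes _ = cong (½ ℚ.*_) (Dseq-sym n (u ∘ suc) (v ∘ suc))
... | yes e | no ¬e = contradiction (sym e) ¬e
... | no ¬e | yes e = contradiction (sym e) ¬e
... | no _  | no _  = refl

Dseq-triangle : ∀ n u v w → Dseq n u w ℚ.≤ Dseq n u v ℚ.+ Dseq n v w
Dseq-triangle zero u v w = ℚ.≤-refl
Dseq-triangle (suc n) u v w with u 0 Bool.≟ w 0 | u 0 Bool.≟ v 0 | v 0 Bool.≟ w 0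
... | yes _ | yes _ | yes _ =
  subst (½ ℚ.* Dseq n (u ∘ suc) (w ∘ suc) ℚ.≤_)
    (ℚ.*-distribˡ-+ ½ (Dseq n (u ∘ suc) (v ∘ suc)) (Dseq n (v ∘ suc) (w ∘ suc)))
    (half-mono (Dseq-triangle n (u ∘ suc) (v ∘ suc) (w ∘ suc)))
... | yes e | yes e′ | no ¬e = contradiction (trans (sym e′) e) ¬e
... | yes e | no ¬e | yes e′ = contradiction (trans e (sym e′)) ¬e
... | yes _ | no _ | no _ =
  ℚ.≤-trans (half-mono (Dseq≤1 n (u ∘ suc) (w ∘ suc)))
    (ℚ.≤-trans (½^≤1 1) (p≤p+q (ℚ.nonNegative⁻¹ 1ℚ)))
... | no ¬e | yes e | yes e′ = contradiction (trans e e′) ¬e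
... | no _ | yes _ | no _ =
  subst (1ℚ ℚ.≤_) (ℚ.+-comm 1ℚ (½ ℚ.* Dseq n (u ∘ suc) (v ∘ suc)))
    (p≤p+q (subst (ℚ._≤ ½ ℚ.* Dseq n (u ∘ suc) (v ∘ suc)) (ℚ.*-zeroʳ ½)
      (half-mono (0≤Dseq n (u ∘ suc) (v ∘ suc)))))
... | no _ | no _ | yes _ =
  p≤p+q (subst (ℚ._≤ ½ ℚ.* Dseq n (v ∘ suc) (w ∘ suc)) (ℚ.*-zeroʳ ½)
    (half-mono (0≤Dseq n (v ∘ suc) (w ∘ suc))))
... | no _ | no _ | no _ = p≤p+q (ℚ.nonNegative⁻¹ 1ℚ)

Dseq-first-difference : ∀ k n u v → (∀ i → i ℕ.< k → u i ≡ v i) → u k ≢ v k →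
                        k ℕ.< n → Dseq n u v ≡ ½^ k
Dseq-first-difference k zero u v _ _ ()
Dseq-first-difference zero (suc n) u v _ ¬e _ with u 0 Bool.≟ v 0
... | yes e = contradiction e ¬e
... | no  _ = refl
Dseq-first-difference (suc k) (suc n) u v h ¬e (s≤s l) with u 0 Bool.≟ v 0
... | yes _  = cong (½ ℚ.*_)
                 (Dseq-first-difference k n (u ∘ suc) (v ∘ suc) (λ i → h (suc i) ∘ s≤s) ¬e l)
... | no ¬e₀ = contradiction (h 0 (s≤s z≤n)) ¬e₀

Dseq-diagonal : ∀ n {u v} → u ≗ v → Dseq n u v ≡ 0ℚ
Dseq-diagonal zero    _ = refl
Dseq-diagonal (suc n) {u} {v} p with u 0 Bool.≟ v 0
... | yes _ = trans (cong (½ ℚ.*_) (Dseq-diagonal n (p ∘ suc))) (ℚ.*-zeroʳ ½)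
... | no ¬e = contradiction (p 0) ¬e

1≰½ : ∀ {p} → p ℚ.≤ 1ℚ → 1ℚ ℚ.≤ ½ ℚ.* p → ∀ {A : Set} → A
1≰½ p≤1 h = contradiction (ℚ.≤-trans h (half-mono p≤1)) (toWitnessFalse {a? = 1ℚ ℚ.≤? ½} _)

Dseq-small : ∀ i n u v → i ℕ.< n → Dseq n u v ℚ.≤ ½^ suc i → u i ≡ v i
Dseq-small i zero u v () _
Dseq-small zero (suc n) u v _ h with u 0 Bool.≟ v 0
... | yes e = e
... | no  _ = 1≰½ (½^≤1 0) h
Dseq-small (suc i) (suc n) u v (s≤s l) h with u 0 Bool.≟ v 0
... | yes _ = Dseq-small i n (u ∘ suc) (v ∘ suc) l (ℚ.*-cancelˡ-≤-pos ½ h)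
... | no  _ = 1≰½ (½^≤1 (suc i)) h

D : (ℕ → Bool) → (ℕ → Bool) → ℝ
seq    (D u v) n = Dseq n u v
cauchy (D u v) k = k , λ m n _ k≤n →
  ℚ.≤-trans (Dseq-cauchy m n u v) (ℚ.+-monoʳ-≤ (Dseq n u v) (½^-anti k≤n))

≡⇒≃ : ∀ {x y} → (∀ n → seq x n ≡ seq y n) → x ≃ y
≡⇒≃ {x} {y} h = ≤-pointwise {x} {y} (ℚ.≤-reflexive ∘ h)
              , ≤-pointwise {y} {x} (ℚ.≤-reflexive ∘ sym ∘ h)

D≤0⇒≗ : ∀ {u v} → D u v ≤ 0ℝ → u ≗ v
D≤0⇒≗ {u} {v} h i with h (suc i)
... | N , p = Dseq-small i n u v (ℕ.m≤n⊔m N (suc i))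
                (subst (Dseq n u v ℚ.≤_) (ℚ.+-identityˡ (½^ suc i)) (p n (ℕ.m≤m⊔n N (suc i))))
  where n = N ℕ.⊔ suc i

Cantor : MetricSpace
Cantor = record
  { Carrier  = ℕ → Bool
  ; _≈_      = _≗_
  ; d        = D
  ; isMetric = record
    { isSemiMetric = record
      { isQuasiSemiMetric = record
        { isPreMetric = record
          { isProtoMetric = record
            { isPartialOrder  = ≤-isPartialOrder
            ; ≈-isEquivalence = record
              { refl  = λ _ → refl
              ; sym   = λ p i → sym (p i)
              ; trans = λ p q i → trans (p i) (q i)
              }
            ; cong            = λ {u} {u′} {v} {v′} p q →
                                  ≡⇒≃ {D u v} {D u′ v′} (λ n → Dseq-cong n p q)
            ; nonNegative     = λ {u} {v} → ≤-pointwise {0ℝ} {D u v} (λ n → 0≤Dseq n u v)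
            }
          ; ≈⇒0 = λ {u} {v} p → ≡⇒≃ {D u v} {0ℝ} (λ n → Dseq-diagonal n p)
          }
        ; 0⇒≈ = λ (p , _) → D≤0⇒≗ p
        }
      ; sym = λ u v → ≡⇒≃ {D u v} {D v u} (λ n → Dseq-sym n u v)
      }
    ; triangle = λ u v w → ≤-pointwise {D u w} {D u v + D v w} (λ n → Dseq-triangle n u v w)
    }
  }

D-first-difference : ∀ k u v → (∀ i → i ℕ.< k → u i ≡ v i) → u k ≢ v k → D u v ≃ 2^- k
D-first-difference k u v h ¬e =
    (λ j → suc k , λ n l → ℚ.≤-trans (ℚ.≤-reflexive (eq n l)) (p≤p+q (0≤½^ j)))
  , (λ j → suc k , λ n l → ℚ.≤-trans (ℚ.≤-reflexive (sym (eq n l))) (p≤p+q (0≤½^ j)))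
  where
  eq : ∀ n → k ℕ.< n → Dseq n u v ≡ ½^ k
  eq n = Dseq-first-difference k n u v h ¬e

IsMinimum : Pred ℕ 0ℓ → ℕ → Set
IsMinimum P m = P m × (∀ n → P n → m ℕ.≤ n)

-- On an empty set this gives 0, the supremum in ℕ.
IsSupremum : Pred ℕ 0ℓ → ℕ → Set
IsSupremum P = IsMinimum (λ m → ∀ n → P n → n ℕ.≤ m)

IsMinimumℝ : Pred ℝ 0ℓ → ℝ → Set
IsMinimumℝ P r = P r × (∀ s → P s → r ≤ s)

Covers : (X : MetricSpace) → ℕ → (N : ℕ) → (Fin N → Carrier X) → Set
Covers X n N centre = ∀ x → ∃[ i ] x ∈ closedBall X (centre i) n

IsUnaryEntropy : MetricSpace → ℕ → ℕ → Set
IsUnaryEntropy X n = IsMinimum (λ N → ∃ (Covers X n N))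

IsRelativeUnaryEntropy : MetricSpace → ℕ → ℕ → ℕ → Set
IsRelativeUnaryEntropy X m n =
  IsSupremum (λ N → ∃[ x ] IsUnaryEntropy (Subspace X (closedBall X x m)) n N)

-- The empty space gets binary entropy 0, since ⌈log₂ 0 ⌉ ≡ 0.
IsBinaryEntropy : MetricSpace → (ℕ → ℕ) → Set
IsBinaryEntropy X η = ∀ n → ∃[ N ] (IsUnaryEntropy X n N × η n ≡ ⌈log₂ N ⌉)

IsRelativeBinaryEntropy : MetricSpace → (ℕ → ℕ → ℕ) → Set
IsRelativeBinaryEntropy X ηᵣ =
  ∀ m n → ∃[ N ] (IsRelativeUnaryEntropy X m n N × ηᵣ m n ≡ ⌈log₂ N ⌉)

Map : MetricSpace → MetricSpace → Set
Map X Y = Func (setoid X) (setoid Y)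

module _ (X Y : MetricSpace) (f : Map X Y) where
  private
    module X = MetricSpace X
    module Y = MetricSpace Y
  open Func f using (to)

  IsModulus : (ℕ → ℕ) → Set
  IsModulus μ =
    (∀ m n → m ℕ.≤ n → μ m ℕ.≤ μ n) ×
    (∀ n x x′ → X.d x x′ ≤ 2^- μ n → Y.d (to x) (to x′) ≤ 2^- n)

  IsMinimalModulus : (ℕ → ℕ) → Set
  IsMinimalModulus μ = IsModulus μ × (∀ ν → IsModulus ν → ∀ n → μ n ℕ.≤ ν n)

record PartialMap (X : MetricSpace) : Set₁ where
  field
    dom      : Pred (ℕ → Bool) 0ℓ
    dom-resp : dom Respects _≗_

  Dom : MetricSpace
  Dom = Subspace Cantor dom

  field
    map : Map Dom X

  open Func map public using (to)

record Representation (X : MetricSpace) : Set₁ where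
  field
    partialMap : PartialMap X
  open PartialMap partialMap public
  field
    surjective : Surjective (MetricSpace._≈_ Dom) (MetricSpace._≈_ X) to

module _ {X : MetricSpace} where
  open MetricSpace X using (_≈_)
  open PartialMap using (Dom; map; to)

  -- For a surjective ξ with a modulus of continuity the minimum exists:
  -- if names of x and x′ come arbitrarily close then x ≈ x′, and a single name
  -- attains 0.
  IsInducedDistance : PartialMap X → Carrier X → Carrier X → ℝ → Set
  IsInducedDistance ξ x x′ = IsMinimumℝ λ r →
    ∃[ u ] ∃[ u′ ] (to ξ u ≈ x × to ξ u′ ≈ x′ × r ≃ MetricSpace.d (Dom ξ) u u′)

  Reduction : (ℕ → ℕ → ℕ) → PartialMap X → PartialMap X → Set
  Reduction bound ξ′ ξ =
    ∃[ μξ ] ∃[ μξ′ ] (IsMinimalModulus (Dom ξ) X (map ξ) μξ × IsMinimalModulus (Dom ξ′) X (map ξ′) μξ′ ×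
    ∃[ G ] ∃[ ν ] (IsModulus (Dom ξ′) (Dom ξ) G ν ×
    (∀ u → to ξ′ u ≈ to ξ (Func.to G u)) ×
    ∃[ c ] (∀ n → ν (μξ n) ℕ.≤ μξ′ (bound c n))))

linear polynomial : ℕ → ℕ → ℕ
linear     c n = c ℕ.+ c ℕ.* n
polynomial c n = c ℕ.+ c ℕ.* n ℕ.^ c

IsLinear IsPolynomial : Pred (ℕ → ℕ) 0ℓ
IsLinear     p = ∃[ c ] p ≗ linear c
IsPolynomial p = Σ (List ℕ) λ as → ∀ n → p n ≡ foldr (λ a r → a ℕ.+ n ℕ.* r) 0 as

module _ {X : MetricSpace} (η : ℕ → ℕ) (ξ : Representation X) where
  private
    module ξ = Representation ξ

  IsStandard : (bound : ℕ → ℕ → ℕ) → Pred (ℕ → ℕ) 0ℓ → Set₁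
  IsStandard bound Admissible =
    (∃[ μξ ] (IsMinimalModulus ξ.Dom X ξ.map μξ × ∃[ c ] (∀ n → μξ n ℕ.≤ η (bound c n)))) ×
    ((ξ′ : PartialMap X) → ∃ (IsModulus (PartialMap.Dom ξ′) X (PartialMap.map ξ′)) → Reduction bound ξ′ ξ.partialMap) ×
    (∃[ p ] (Admissible p × (∀ n x x′ → MetricSpace.d X x x′ ≤ 2^- p n →
      ∃[ r ] (IsInducedDistance ξ.partialMap x x′ r × r ≤ 2^- η n))))

  IsLinearlyStandard IsPolynomiallyStandard : Set₁
  IsLinearlyStandard     = IsStandard linear IsLinear
  IsPolynomiallyStandard = IsStandard polynomial IsPolynomial

-- n_{K-1} < n, where n_{-1} = -∞
PreviousBelow : (ℕ → ℕ) → ℕ → ℕ → Set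
PreviousBelow n⟨_⟩ zero    n = ⊤
PreviousBelow n⟨_⟩ (suc K) n = n⟨ K ⟩ ℕ.< n

IsBlockModulus : (η : ℕ → ℕ) (ηᵣ : ℕ → ℕ → ℕ) (n⟨_⟩ : ℕ → ℕ) (μ : ℕ → ℕ) → Set
IsBlockModulus η ηᵣ n⟨_⟩ μ = ∀ K n → PreviousBelow n⟨_⟩ K n → n ℕ.≤ n⟨ K ⟩ →
  μ n ≡ η (1 ℕ.+ n⟨ 0 ⟩) ℕ.+ sum (applyUpTo (λ k → ηᵣ n⟨ k ⟩ (1 ℕ.+ n⟨ suc k ⟩)) (suc K))

-- A name of x is a concatenation of blocks.  The first block selects a centre x₀ of a minimal cover of
-- X by balls of radius 2^-(1+n₀), block k+1 a centre x_{k+1} of a minimal cover of B(x_k, 2^-n_k) by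
-- balls of radius 2^-(1+n_{k+1}); the sequence is a name of x when d(x_k, x) ≤ 2^-n_k for all k.  This
-- tolerance is twice the covering radius, and the factor 2 is used twice.  For condition (3), the
-- optimal centres of x up to level K are admissible for every x′ with d(x, x′) ≤ 2^-(1+n_K), so x and
-- x′ have names agreeing on these blocks, which number at least η(1+n_K) bits since they code a
-- cover.  For condition (2′), block k of the name G(u) may be computed from a representative of the
-- prefix of u that determines ξ′(u) up to 2^-(1+n_k) instead of from u itself, so that this prefix
-- determines the block.
module Submission where

open import Level using (0ℓ)
open import Axiom.ExcludedMiddle using (ExcludedMiddle)
open import Data.Nat.Base using (ℕ; suc; _≤_; _<_)
open import Data.Product.Base using (Σ; _×_; ∃-syntax)
open import Defs using (MetricSpace; IsCompact; IsBinaryEntropy; IsRelativeBinaryEntropy; IsBlockModulus; linear; polynomial; Representation; IsModulus; IsLinearlyStandard; IsPolynomiallyStandard)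

open import Data.Bool.Base using (Bool; true; false)
import Data.Bool.Properties as Bool
open import Data.Fin.Base using (Fin; toℕ; fromℕ<)
import Data.Fin.Properties as Fin
open import Data.List.Base using (List; []; _∷_; foldr; applyUpTo; _∷ʳ_)
open import Data.List.Properties using (applyUpTo-∷ʳ)
open import Data.Nat.Base using (zero; z≤n; s≤s; z<s; _+_; _*_; _∸_; _^_; _⊔_; _/_; _%_; ⌈_/2⌉; ⌊_/2⌋; NonZero)
open import Data.Nat.Divisibility using (divides-refl)
open import Data.Nat.DivMod using (m≡m%n+[m/n]*n; [m+kn]%n≡m%n; m%n<n; +-distrib-/-∣ʳ; m*n/n≡m; m<n*o⇒m/o<n)
open import Data.Nat.Induction using (<-rec)
open import Data.Nat.ListAction using (sum)
open import Data.Nat.ListAction.Properties using (sum-++)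
open import Data.Nat.Logarithm using (⌈log₂_⌉; ⌈log₂⌉-mono-≤; ⌈log₂⌈n/2⌉⌉≡⌈log₂n⌉∸1; ⌈log₂2^n⌉≡n)
import Data.Nat.Properties as ℕ
open import Data.Nat.Tactic.RingSolver using (solve-∀)
open import Data.Product.Base using (∃; _,_; proj₁; proj₂)
open import Data.Rational.Base as ℚ using (½; 0ℚ; 1ℚ)
import Data.Rational.Properties as ℚ
open import Data.Sum.Base using (_⊎_; inj₁; inj₂; [_,_]′)
open import Function.Base using (_∘_)
open import Function.Bundles using (Func)
open import Function.Metric.Structures using (IsGeneralMetric)
open import Relation.Binary.PropositionalEquality
  using (_≡_; refl; sym; trans; cong; cong₂; subst; module ≡-Reasoning)
open import Relation.Nullary.Decidable using (yes; no)
open import Relation.Nullary.Negation using (¬_; contradiction)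
open import Relation.Unary using (Pred)
open import Defs using (ℝ; ½^_; 2^-_; 0ℝ; D; Dseq; Dseq≤1; Subspace; Cantor; closedBall; Covers; IsMinimum;
  Map; IsMinimalModulus; PartialMap; IsInducedDistance; Reduction; IsStandard; IsLinear; IsPolynomial; PreviousBelow;
  half+half; half-mono; 0≤½^; ½^≤1; ½^-anti; p≤p+q; interchange; ≤-pointwise)
  renaming (_≤_ to _≤ℝ_; _≃_ to _≃ℝ_; _+_ to _+ℝ_; ≤-refl to ≤ℝ-refl; ≤-trans to ≤ℝ-trans)

open ℝ using (seq)

-- Dyadic estimates for reals and metrics

2^-anti : ∀ {m n} → m ≤ n → 2^- n ≤ℝ 2^- m
2^-anti {m} {n} m≤n = ≤-pointwise {2^- n} {2^- m} (λ _ → ½^-anti m≤n)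

+ℝ-halves : ∀ n x y → x ≤ℝ 2^- suc n → y ≤ℝ 2^- suc n → (x +ℝ y) ≤ℝ 2^- n
+ℝ-halves n x y x≤ y≤ k with x≤ (suc k) | y≤ (suc k)
... | M , p | N , q = M ⊔ N , λ i l →
  subst (seq x i ℚ.+ seq y i ℚ.≤_)
    (trans (interchange (½^ suc n) _ (½^ suc n) _) (cong₂ ℚ._+_ (half+half (½^ n)) (half+half (½^ k))))
    (ℚ.+-mono-≤ (p i (ℕ.m⊔n≤o⇒m≤o M N l)) (q i (ℕ.m⊔n≤o⇒n≤o M N l)))

≤2^-⇒≤0 : ∀ x → (∀ n → x ≤ℝ 2^- n) → x ≤ℝ 0ℝ
≤2^-⇒≤0 x h k with h (suc k) (suc k)
... | N , p = N , λ i l →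
  subst (seq x i ℚ.≤_) (trans (half+half (½^ k)) (sym (ℚ.+-identityˡ (½^ k)))) (p i l)

module MetricProperties (X : MetricSpace) where
  open MetricSpace X
  open IsGeneralMetric isMetric

  d-weaken : ∀ {m n} → m ≤ n → ∀ x y → d x y ≤ℝ 2^- n → d x y ≤ℝ 2^- m
  d-weaken {m} {n} m≤n x y h = ≤ℝ-trans {d x y} {2^- n} {2^- m} h (2^-anti m≤n)

  d-sym : ∀ x y n → d x y ≤ℝ 2^- n → d y x ≤ℝ 2^- n
  d-sym x y n h = ≤ℝ-trans {d y x} {d x y} {2^- n} (proj₁ (IsGeneralMetric.sym isMetric y x)) h

  d-refl : ∀ x n → d x x ≤ℝ 2^- n
  d-refl x n = ≤ℝ-trans {d x x} {0ℝ} {2^- n} (proj₁ (≈⇒0 (EqC.refl {x})))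
                 (≤-pointwise {0ℝ} {2^- n} (λ _ → 0≤½^ n))

  d-triangle : ∀ n x y z → d x y ≤ℝ 2^- suc n → d y z ≤ℝ 2^- suc n → d x z ≤ℝ 2^- n
  d-triangle n x y z p q = ≤ℝ-trans {d x z} {d x y +ℝ d y z} {2^- n} (triangle x y z)
                             (+ℝ-halves n (d x y) (d y z) p q)

  d-resp : ∀ {x x′ y y′} n → x ≈ x′ → y ≈ y′ → d x y ≤ℝ 2^- n → d x′ y′ ≤ℝ 2^- n
  d-resp {x} {x′} {y} {y′} n p q h =
    ≤ℝ-trans {d x′ y′} {d x y} {2^- n} (proj₂ (IsGeneralMetric.cong isMetric p q)) h

  separated : ∀ x y → (∀ n → d x y ≤ℝ 2^- n) → x ≈ y
  separated x y h = 0⇒≈ (≤2^-⇒≤0 (d x y) h , nonNegative)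

-- Prefixes of binary sequences

Agree : ℕ → (ℕ → Bool) → (ℕ → Bool) → Set
Agree m u v = ∀ i → i < m → u i ≡ v i

Agree-sym : ∀ {m u v} → Agree m u v → Agree m v u
Agree-sym a i l = sym (a i l)

Agree-trans : ∀ {m u v w} → Agree m u v → Agree m v w → Agree m u w
Agree-trans a b i l = trans (a i l) (b i l)

Agree-weaken : ∀ {m n u v} → m ≤ n → Agree n u v → Agree m u v
Agree-weaken m≤n a i l = a i (ℕ.<-≤-trans l m≤n)

-- A difference at some position at most i, visible because `i < n`, would make the value at least
-- `½^ i`.
Dseq<½^⇒≡ : ∀ i n u v → i < n → Dseq n u v ℚ.< ½^ i → u i ≡ v i
Dseq<½^⇒≡ i       zero    u v () _
Dseq<½^⇒≡ zero    (suc n) u v _ h with u 0 Bool.≟ v 0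
... | yes e = e
... | no  _ = contradiction h (ℚ.<-irrefl refl)
Dseq<½^⇒≡ (suc i) (suc n) u v (s≤s l) h with u 0 Bool.≟ v 0
... | yes _ = Dseq<½^⇒≡ i n (u ∘ suc) (v ∘ suc) l (ℚ.*-cancelˡ-<-nonNeg ½ h)
... | no  _ = contradiction (ℚ.<-≤-trans h (½^≤1 (suc i))) (ℚ.<-irrefl refl)

Agree⇒Dseq≤½^ : ∀ m n u v → Agree m u v → Dseq n u v ℚ.≤ ½^ m
Agree⇒Dseq≤½^ m       zero    u v a = 0≤½^ m
Agree⇒Dseq≤½^ zero    (suc n) u v a = Dseq≤1 (suc n) u v
Agree⇒Dseq≤½^ (suc m) (suc n) u v a with u 0 Bool.≟ v 0
... | yes _ = half-mono (Agree⇒Dseq≤½^ m n (u ∘ suc) (v ∘ suc) (λ i l → a (suc i) (s≤s l)))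
... | no ¬e = contradiction (a 0 z<s) ¬e

½^-pos : ∀ n → 0ℚ ℚ.< ½^ n
½^-pos zero    = ℚ.positive⁻¹ 1ℚ
½^-pos (suc n) = subst (ℚ._< ½^ suc n) (ℚ.*-zeroʳ ½) (ℚ.*-monoʳ-<-pos ½ (½^-pos n))

½^-strict : ∀ n → ½^ suc n ℚ.< ½^ n
½^-strict n = ℚ.<-respˡ-≡ (ℚ.+-identityʳ (½^ suc n)) (ℚ.<-respʳ-≡ (half+half (½^ n))
                (ℚ.+-monoʳ-< (½^ suc n) (½^-pos (suc n))))

D≤⇒Agree : ∀ m u v → D u v ≤ℝ 2^- m → Agree m u v
-- The slack ½^(m+1) is strictly below ½^m, so the approximation stays strictly below 2 · ½^m, which
-- is at most `½^ i` for i < m. The index n is large enough both for the estimate and to inspect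
-- digit i.
D≤⇒Agree m u v h i i<m with h (suc m)
... | N , p = Dseq<½^⇒≡ i n u v (ℕ.m≤n⊔m N (suc i))
  (ℚ.≤-<-trans (p n (ℕ.m≤m⊔n N (suc i)))
    (ℚ.<-≤-trans (ℚ.+-monoʳ-< (½^ m) (½^-strict m))
      (ℚ.≤-trans (ℚ.≤-reflexive (ℚ.+-comm (½^ m) (½^ m))) (double m i i<m))))
  where
  n = N ⊔ suc i
  double : ∀ m i → i < m → ½^ m ℚ.+ ½^ m ℚ.≤ ½^ i
  double (suc m) i (s≤s i≤m) = subst (ℚ._≤ ½^ i) (sym (half+half (½^ m))) (½^-anti i≤m)

Agree⇒D≤ : ∀ m u v → Agree m u v → D u v ≤ℝ 2^- m
Agree⇒D≤ m u v a = ≤-pointwise {D u v} {2^- m} (λ n → Agree⇒Dseq≤½^ m n u v a)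

-- Rational approximations can be compared: if one with index above k fell below `½^ k`, all digits
-- up to position k would agree.
¬Agree⇒≤D : ∀ k u v → ¬ Agree (suc k) u v → 2^- k ≤ℝ D u v
¬Agree⇒≤D k u v ¬a j = suc k , λ n l → ℚ.≤-trans (far n l) (p≤p+q (0≤½^ j))
  where
  far : ∀ n → k < n → ½^ k ℚ.≤ Dseq n u v
  far n k<n = ℚ.≮⇒≥ λ lt → ¬a λ { i (s≤s i≤k) →
    Dseq<½^⇒≡ i n u v (ℕ.≤-<-trans i≤k k<n) (ℚ.<-≤-trans lt (½^-anti i≤k)) }

splice : ℕ → (ℕ → Bool) → (ℕ → Bool) → ℕ → Bool
splice zero    u w j       = w j
splice (suc m) u w zero    = u 0
splice (suc m) u w (suc j) = splice m (u ∘ suc) w j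

splice-below : ∀ m u w → Agree m u (splice m u w)
splice-below (suc m) u w zero    _       = refl
splice-below (suc m) u w (suc i) (s≤s l) = splice-below m (u ∘ suc) w i l

splice-above : ∀ m u w j → splice m u w (m + j) ≡ w j
splice-above zero    u w j = refl
splice-above (suc m) u w j = splice-above m (u ∘ suc) w j

-- Binary codes of numbers, first digit least significant

bit : Bool → ℕ
bit false = 0
bit true  = 1

isOdd : ℕ → Bool
isOdd n with n % 2
... | zero  = false
... | suc _ = true

index : ℕ → (ℕ → Bool) → ℕ
index zero    u = 0
index (suc b) u = bit (u 0) + index b (u ∘ suc) * 2

digits : ℕ → ℕ → Bool
digits i zero    = isOdd i
digits i (suc j) = digits (i / 2) j

bit-isOdd : ∀ n → bit (isOdd n) ≡ n % 2
bit-isOdd n with n % 2 | m%n<n n 2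
... | zero        | _ = refl
... | suc zero    | _ = refl
... | suc (suc _) | s≤s (s≤s ())

isOdd-bit : ∀ a n → isOdd (bit a + n * 2) ≡ a
isOdd-bit a n with (bit a + n * 2) % 2 | [m+kn]%n≡m%n (bit a) n 2
isOdd-bit false n | _ | refl = refl
isOdd-bit true  n | _ | refl = refl

bit-half : ∀ a n → (bit a + n * 2) / 2 ≡ n
bit-half a n = trans (+-distrib-/-∣ʳ (bit a) (divides-refl n)) (cong₂ _+_ (bit/2 a) (m*n/n≡m n 2))
  where
  bit/2 : ∀ a → bit a / 2 ≡ 0
  bit/2 false = refl
  bit/2 true  = refl

index-digits : ∀ b i → i < 2 ^ b → index b (digits i) ≡ i
index-digits zero    zero    _ = refl
index-digits zero    (suc i) (s≤s ())
index-digits (suc b) i       l = begin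
  bit (isOdd i) + index b (digits (i / 2)) * 2 ≡⟨ cong₂ (λ a n → a + n * 2) (bit-isOdd i) (index-digits b (i / 2) i/2<) ⟩
  i % 2 + i / 2 * 2                            ≡⟨ m≡m%n+[m/n]*n i 2 ⟨
  i                                            ∎
  where
  open ≡-Reasoning
  i/2< : i / 2 < 2 ^ b
  i/2< = m<n*o⇒m/o<n (subst (i <_) (ℕ.*-comm 2 (2 ^ b)) l)

digits-index : ∀ b u → Agree b (digits (index b u)) u
digits-index (suc b) u zero    _       = isOdd-bit (u 0) (index b (u ∘ suc))
digits-index (suc b) u (suc i) (s≤s l) =
  trans (cong (λ n → digits n i) (bit-half (u 0) (index b (u ∘ suc)))) (digits-index b (u ∘ suc) i l)

index<2^ : ∀ b u → index b u < 2 ^ b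
index<2^ zero    u = z<s
index<2^ (suc b) u = begin-strict
  bit (u 0) + index b (u ∘ suc) * 2 <⟨ ℕ.+-monoˡ-< _ (bit<2 (u 0)) ⟩
  2 + index b (u ∘ suc) * 2         ≤⟨ ℕ.*-monoˡ-≤ 2 (index<2^ b (u ∘ suc)) ⟩
  2 ^ b * 2                         ≡⟨ ℕ.*-comm (2 ^ b) 2 ⟩
  2 ^ suc b                         ∎
  where
  open ℕ.≤-Reasoning
  bit<2 : ∀ a → bit a < 2
  bit<2 false = s≤s z≤n
  bit<2 true  = s≤s (s≤s z≤n)

index-cong : ∀ b {u v} → Agree b u v → index b u ≡ index b v
index-cong zero    a = refl
index-cong (suc b) a = cong₂ (λ x n → bit x + n * 2) (a 0 z<s) (index-cong b (λ i l → a (suc i) (s≤s l)))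

-- Strong induction by halving: n is at most twice ⌈n/2⌉, whose logarithm is smaller by one.
n≤2^⌈log₂n⌉ : ∀ n → n ≤ 2 ^ ⌈log₂ n ⌉
n≤2^⌈log₂n⌉ = <-rec (λ n → n ≤ 2 ^ ⌈log₂ n ⌉) step
  where
  open ℕ.≤-Reasoning
  step : ∀ n → (∀ {m} → m < n → m ≤ 2 ^ ⌈log₂ m ⌉) → n ≤ 2 ^ ⌈log₂ n ⌉
  step zero          _   = z≤n
  step (suc zero)    _   = s≤s z≤n
  step n@(suc (suc m)) rec = begin
    n                        ≡⟨ ℕ.⌊n/2⌋+⌈n/2⌉≡n n ⟨
    ⌊ n /2⌋ + ⌈ n /2⌉        ≤⟨ ℕ.+-monoˡ-≤ ⌈ n /2⌉ (ℕ.⌊n/2⌋≤⌈n/2⌉ n) ⟩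
    ⌈ n /2⌉ + ⌈ n /2⌉        ≡⟨ cong (⌈ n /2⌉ +_) (ℕ.+-identityʳ ⌈ n /2⌉) ⟨
    2 * ⌈ n /2⌉              ≤⟨ ℕ.*-monoʳ-≤ 2 (rec (ℕ.⌈n/2⌉<n m)) ⟩
    2 ^ suc ⌈log₂ ⌈ n /2⌉ ⌉  ≡⟨ cong (λ e → 2 ^ suc e) (⌈log₂⌈n/2⌉⌉≡⌈log₂n⌉∸1 n) ⟩
    2 ^ ⌈log₂ n ⌉            ∎

-- Consequences of excluded middle

module Classical (em : ExcludedMiddle 0ℓ) where

  least : ∀ {P : Pred ℕ 0ℓ} → ∃ P → ∃ (IsMinimum P)
  least {P} (n , Pn) = <-rec (λ n → P n → ∃ (IsMinimum P)) search n Pn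
    where
    search : ∀ n → (∀ {m} → m < n → P m → ∃ (IsMinimum P)) → P n → ∃ (IsMinimum P)
    search n rec Pn with em {∃[ m ] (m < n × P m)}
    ... | yes (m , m<n , Pm) = rec m<n Pm
    ... | no none            = n , Pn , λ m Pm → ℕ.≮⇒≥ λ m<n → none (m , m<n , Pm)

  -- A choice function on inhabited types: the element comes from the decision of A, so it does not
  -- depend on the argument, which only shows that A is inhabited.
  canonical : ∀ {A : Set} → A → A
  canonical {A} a with em {A}
  ... | yes a₀ = a₀
  ... | no  _  = a

  canonical-const : ∀ {A : Set} (a b : A) → canonical a ≡ canonical b
  canonical-const {A} a b with em {A}
  ... | yes _ = refl
  ... | no ¬a = contradiction a ¬a

  last-true : ∀ (P : Pred ℕ 0ℓ) → P 0 → (∀ n → P n) ⊎ (∃[ n ] (P n × ¬ P (suc n)))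
  last-true P P0 with em {∃[ n ] (P n × ¬ P (suc n))}
  ... | yes w    = inj₂ w
  ... | no  none = inj₁ all
    where
    all : ∀ n → P n
    all zero = P0
    all (suc n) with em {P (suc n)}
    ... | yes p = p
    ... | no ¬p = contradiction (n , all n , ¬p) none

  -- Minimal moduli of continuity

  module _ (X Y : MetricSpace) (f : Map X Y) where
    private
      module X = MetricSpace X
      module Y = MetricSpace Y
    open Func f using (to)

    ModulusAt : ℕ → ℕ → Set
    ModulusAt n k = ∀ x x′ → X.d x x′ ≤ℝ 2^- k → Y.d (to x) (to x′) ≤ℝ 2^- n

    -- The least admissible value is taken for each n separately; it is monotone because what is
    -- admissible for n is admissible for every smaller m. Minimality is stated at single arguments,
    -- so that a bound known only at some n can be used.
    least-modulus : (∀ n → ∃ (ModulusAt n)) →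
                    ∃[ μ ] (IsModulus X Y f μ × (∀ n k → ModulusAt n k → μ n ≤ k))
    least-modulus h = μ , ((λ m n m≤n → μ-min m (μ n) (weaken (μ n) m≤n (μ-at n))) , μ-at) , μ-min
      where
      μ : ℕ → ℕ
      μ n = proj₁ (least (h n))
      μ-at : ∀ n → ModulusAt n (μ n)
      μ-at n = proj₁ (proj₂ (least (h n)))
      μ-min : ∀ n k → ModulusAt n k → μ n ≤ k
      μ-min n = proj₂ (proj₂ (least (h n)))
      weaken : ∀ {m n} k → m ≤ n → ModulusAt n k → ModulusAt m k
      weaken _ m≤n at x x′ l = MetricProperties.d-weaken Y m≤n (to x) (to x′) (at x x′ l)

    minimal-modulus : ∃ (IsModulus X Y f) → ∃ (IsMinimalModulus X Y f)
    minimal-modulus (ν , _ , at) with least-modulus (λ n → ν n , at n)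
    ... | μ , mod , min = μ , mod , λ ν′ (_ , at′) n → min n (ν′ n) (at′ n)

  -- Limits of coherent prefixes

  module _ (l : ℕ → ℕ) where

    -- The lengths l k may be bounded (as they are for finite X); the digits beyond are false.
    limit : (ℕ → ℕ → Bool) → ℕ → Bool
    limit v j with em {∃[ k ] j < l k}
    ... | yes (k , _) = v k j
    ... | no  _       = false

    -- The stage from which digit j is read depends on l alone, hence one stage serves all v at
    -- once.
    limit-digit : ∀ j → (∃[ k ] (∀ v → limit v j ≡ v k j)) ⊎ (∀ v → limit v j ≡ false)
    limit-digit j with em {∃[ k ] j < l k}
    ... | yes (k , _) = inj₁ (k , λ _ → refl)
    ... | no  _       = inj₂ λ _ → refl

    module _ (l-step : ∀ k → l k ≤ l (suc k)) where

      module _ (v : ℕ → ℕ → Bool) (v-step : ∀ k → Agree (l k) (v k) (v (suc k))) where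

        coherent : ∀ k e → Agree (l k) (v k) (v (e + k))
        coherent k zero    i _ = refl
        coherent k (suc e) i p = trans (coherent k e i p) (v-step (e + k) i (ℕ.<-≤-trans p (mono e)))
          where
          mono : ∀ e → l k ≤ l (e + k)
          mono zero    = ℕ.≤-refl
          mono (suc e) = ℕ.≤-trans (mono e) (l-step (e + k))

        coherent-≤ : ∀ {k k′} → k ≤ k′ → Agree (l k) (v k) (v k′)
        coherent-≤ {k} {k′} p = subst (λ m → Agree (l k) (v k) (v m)) (ℕ.m∸n+n≡m p) (coherent k (k′ ∸ k))

        limit-agree : ∀ k → Agree (l k) (v k) (limit v)
        limit-agree k j j<lk with em {∃[ k ] j < l k}
        ... | no none = contradiction (k , j<lk) none
        ... | yes (k′ , j<lk′) with ℕ.≤-total k k′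
        ...   | inj₁ k≤k′ = coherent-≤ k≤k′ j j<lk
        ...   | inj₂ k′≤k = sym (coherent-≤ k′≤k j j<lk′)

      -- Iterating `next` gives stages whose successive agreement makes the limit agree with stage j
      -- below `l j`. The property C is obtained for the stages only; it passes to the limit when it
      -- depends on that prefix.
      dependent-limit : (C : ℕ → (ℕ → Bool) → Set) →
        (∀ j u → C j u → ∃[ v ] (Agree (l j) u v × C (suc j) v)) →
        ∀ u → C 0 u → ∃[ w ] (Agree (l 0) u w × (∀ j → ∃[ v ] (C j v × Agree (l j) v w)))
      dependent-limit C next u c = limit v , limit-agree v v-step 0 , λ j → v j , proj₂ (stage j) , limit-agree v v-step j
        where
        stage : ∀ j → ∃ (C j)
        stage zero    = u , c
        stage (suc j) = let v , _ , c′ = next j (proj₁ (stage j)) (proj₂ (stage j)) in v , c′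
        v : ℕ → ℕ → Bool
        v j = proj₁ (stage j)
        v-step : ∀ j → Agree (l j) (v j) (v (suc j))
        v-step j = proj₁ (proj₂ (next j (proj₁ (stage j)) (proj₂ (stage j))))

  -- Covers with entropy many bits

  module Covering (X : MetricSpace) (η : ℕ → ℕ) (η-entropy : IsBinaryEntropy X η)
                  (ηᵣ : ℕ → ℕ → ℕ) (ηᵣ-entropy : IsRelativeBinaryEntropy X ηᵣ) where
    open MetricSpace X
    open MetricProperties X

    abstract

      η-mono : ∀ {m n} → m ≤ n → η m ≤ η n
      η-mono {m} {n} m≤n with η-entropy m | η-entropy n
      ... | M , (_ , M-min) , e | N , ((c , cov) , _) , e′ =
        subst (_≤ η n) (sym e) (subst (⌈log₂ M ⌉ ≤_) (sym e′) (⌈log₂⌉-mono-≤ (M-min N (c , cov-m))))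
        where
        cov-m : Covers X m N c
        cov-m x = let i , h = cov x in i , d-weaken m≤n (c i) x h

      -- The empty space has η = 0, so a cover is needed only in the presence of a point.
      η-least : ∀ n L → (Carrier → ∃ (Covers X n (2 ^ L))) → η n ≤ L
      η-least n L cov with η-entropy n | em {Carrier}
      ... | N , (_ , N-min) , e | yes x₀ = subst (_≤ L) (sym e)
        (subst (⌈log₂ N ⌉ ≤_) (⌈log₂2^n⌉≡n L) (⌈log₂⌉-mono-≤ (N-min (2 ^ L) (cov x₀))))
      ... | N , (_ , N-min) , e | no empty = subst (_≤ L) (sym e)
        (ℕ.≤-trans (⌈log₂⌉-mono-≤ (N-min 0 ((λ ()) , λ x → contradiction x empty))) z≤n)

      cover : ∀ n → ∃[ N ] (N ≤ 2 ^ η n × ∃ (Covers X n N))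
      cover n with η-entropy n
      ... | N , (cov , _) , e = N , subst (λ b → N ≤ 2 ^ b) (sym e) (n≤2^⌈log₂n⌉ N) , cov

      -- Centres of a finer cover are moved into the ball, at the price of doubling the radius.
      ball-cover : ∀ m n z → ∃[ N ] ∃ (Covers (Subspace X (closedBall X z m)) n N)
      ball-cover m n z with cover (suc n)
      ... | N , _ , c , cov = N , c′ , cov′
        where
        c′ : Fin N → Σ Carrier (closedBall X z m)
        c′ i with em {∃[ y ] (closedBall X z m y × closedBall X (c i) (suc n) y)}
        ... | yes (y , h , _) = y , h
        -- A default for balls that miss the set to be covered; `cov′` never selects them.
        ... | no  _           = z , d-refl z m
        cov′ : Covers (Subspace X (closedBall X z m)) n N c′
        cov′ (x , h) with cov x
        ... | i , cx = i , close
          where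
          close : d (proj₁ (c′ i)) x ≤ℝ 2^- n
          close with em {∃[ y ] (closedBall X z m y × closedBall X (c i) (suc n) y)}
          ... | yes (y , _ , cy) = d-triangle n y (c i) x (d-sym (c i) y (suc n) cy) cx
          ... | no none          = contradiction (x , h , cx) none

      -- The supremum bounds only numbers that are entropies of some ball. The entropy of the ball
      -- around z exists as the least size of its covers, one being given by `ball-cover`.
      relative-cover : ∀ m n z → ∃[ N ] (N ≤ 2 ^ ηᵣ m n × ∃ (Covers (Subspace X (closedBall X z m)) n N))
      relative-cover m n z with least (ball-cover m n z) | ηᵣ-entropy m n
      ... | N , isMin | M , (ub , _) , e = N
        , ℕ.≤-trans (ub N (z , isMin)) (subst (λ b → M ≤ 2 ^ b) (sym e) (n≤2^⌈log₂n⌉ M))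
        , proj₁ isMin

  -- Attainment of the induced distance

  module InducedDistance (X : MetricSpace) (ξ : PartialMap X) (μ : ℕ → ℕ)
                         (μ-modulus : IsModulus (PartialMap.Dom ξ) X (PartialMap.map ξ) μ) where
    open MetricSpace X
    open MetricProperties X
    open PartialMap ξ
    open IsGeneralMetric isMetric using (module EqC)
    private
      module Cantor = IsGeneralMetric (MetricSpace.isMetric Cantor)

      NamesAgree : Carrier → Carrier → Pred ℕ 0ℓ
      NamesAgree x x′ k = ∃[ u ] ∃[ u′ ] (to u ≈ x × to u′ ≈ x′ × Agree k (proj₁ u) (proj₁ u′))

    -- If some length k of a common prefix cannot be increased by one, names attaining k are
    -- closest, since all others differ at or before position k. Otherwise names come arbitrarily
    -- close, the modulus identifies the points, and a single name attains 0.
    induced-distance : ∀ x x′ → (∃[ u ] to u ≈ x) → (∃[ u ] to u ≈ x′) → ∃ (IsInducedDistance ξ x x′)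
    induced-distance x x′ (u , ux) (u′ , u′x′) = attain (last-true (NamesAgree x x′) (u , u′ , ux , u′x′ , λ _ ()))
      where
      w = proj₁ u
      attain : (∀ k → NamesAgree x x′ k) ⊎ (∃[ k ] (NamesAgree x x′ k × ¬ NamesAgree x x′ (suc k))) →
               ∃ (IsInducedDistance ξ x x′)
      attain (inj₁ close) = D w w , (u , u , ux , EqC.trans ux x≈x′ , ≤ℝ-refl {D w w} , ≤ℝ-refl {D w w}) , minimal
        where
        x≈x′ : x ≈ x′
        x≈x′ = separated x x′ λ n → let v , v′ , p , p′ , a = close (μ n) in
          d-resp n p p′ (proj₂ μ-modulus n v v′ (Agree⇒D≤ (μ n) (proj₁ v) (proj₁ v′) a))
        minimal : ∀ s → (∃[ v ] ∃[ v′ ] (to v ≈ x × to v′ ≈ x′ × s ≃ℝ D (proj₁ v) (proj₁ v′))) → D w w ≤ℝ s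
        minimal s (v , v′ , _ , _ , _ , h) =
          ≤ℝ-trans {D w w} {0ℝ} {s} (proj₁ (Cantor.≈⇒0 {w} {w} (λ _ → refl)))
            (≤ℝ-trans {0ℝ} {D (proj₁ v) (proj₁ v′)} {s} (Cantor.nonNegative {proj₁ v} {proj₁ v′}) h)
      attain (inj₂ (k , (v , v′ , p , p′ , a) , apart)) = r , (v , v′ , p , p′ , ≤ℝ-refl {r} , ≤ℝ-refl {r}) , minimal
        where
        r = D (proj₁ v) (proj₁ v′)
        minimal : ∀ s → (∃[ v ] ∃[ v′ ] (to v ≈ x × to v′ ≈ x′ × s ≃ℝ D (proj₁ v) (proj₁ v′))) → r ≤ℝ s
        minimal s (w , w′ , q , q′ , _ , h) =
          ≤ℝ-trans {r} {2^- k} {s} (Agree⇒D≤ k (proj₁ v) (proj₁ v′) a)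
            (≤ℝ-trans {2^- k} {D (proj₁ w) (proj₁ w′)} {s}
              (¬Agree⇒≤D k (proj₁ w) (proj₁ w′) (λ b → apart (w , w′ , q , q′ , b))) h)

    induced-distance-≤ : ∀ x x′ r → IsInducedDistance ξ x x′ r → ∀ u u′ → to u ≈ x → to u′ ≈ x′ →
                         ∀ m → Agree m (proj₁ u) (proj₁ u′) → r ≤ℝ 2^- m
    induced-distance-≤ x x′ r (_ , minimal) u u′ p p′ m a =
      ≤ℝ-trans {r} {s} {2^- m} (minimal s (u , u′ , p , p′ , ≤ℝ-refl {s} , ≤ℝ-refl {s}))
        (Agree⇒D≤ m (proj₁ u) (proj₁ u′) a)
      where s = D (proj₁ u) (proj₁ u′)

  -- The representation

  module Coding (X : MetricSpace) (η : ℕ → ℕ) (η-entropy : IsBinaryEntropy X η)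
                (ηᵣ : ℕ → ℕ → ℕ) (ηᵣ-entropy : IsRelativeBinaryEntropy X ηᵣ)
                (n⟨_⟩ : ℕ → ℕ) (n-increasing : ∀ k → n⟨ k ⟩ < n⟨ suc k ⟩) where
    open MetricSpace X
    open MetricProperties X
    open Covering X η η-entropy ηᵣ ηᵣ-entropy

    n-mono : ∀ {j k} → j ≤ k → n⟨ j ⟩ ≤ n⟨ k ⟩
    n-mono {j} {k} j≤k = subst (λ m → n⟨ j ⟩ ≤ n⟨ m ⟩) (ℕ.m∸n+n≡m j≤k) (up (k ∸ j))
      where
      up : ∀ e → n⟨ j ⟩ ≤ n⟨ e + j ⟩
      up zero    = ℕ.≤-refl
      up (suc e) = ℕ.≤-trans (up e) (ℕ.<⇒≤ (n-increasing (e + j)))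

    k≤n⟨k⟩ : ∀ k → k ≤ n⟨ k ⟩
    k≤n⟨k⟩ zero    = z≤n
    k≤n⟨k⟩ (suc k) = ℕ.≤-<-trans (k≤n⟨k⟩ k) (n-increasing k)

    block : ℕ → ℕ
    block k = ηᵣ n⟨ k ⟩ (1 + n⟨ suc k ⟩)

    -- The position where block k + 1 of a name begins; `block k` is the length of that block. Hence
    -- `μ n` is `L (suc K)` for n_{K-1} < n ≤ n_K: one block beyond block K is read.
    L : ℕ → ℕ
    L k = η (1 + n⟨ 0 ⟩) + sum (applyUpTo block k)

    L-suc : ∀ k → L (suc k) ≡ L k + block k
    L-suc k = begin
      η₀ + sum (applyUpTo block (suc k))        ≡⟨ cong (λ bs → η₀ + sum bs) (applyUpTo-∷ʳ block k) ⟨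
      η₀ + sum (applyUpTo block k ∷ʳ block k)   ≡⟨ cong (η₀ +_) (sum-++ (applyUpTo block k) (block k ∷ [])) ⟩
      η₀ + (sum (applyUpTo block k) + (block k + 0)) ≡⟨ ℕ.+-assoc η₀ _ _ ⟨
      L k + (block k + 0)                       ≡⟨ cong (L k +_) (ℕ.+-identityʳ (block k)) ⟩
      L k + block k                             ∎
      where
      open ≡-Reasoning
      η₀ = η (1 + n⟨ 0 ⟩)

    L-step : ∀ k → L k ≤ L (suc k)
    L-step k = subst (L k ≤_) (sym (L-suc k)) (ℕ.m≤m+n (L k) (block k))

    L-mono : ∀ {j k} → j ≤ k → L j ≤ L k
    L-mono {j} {k} j≤k = subst (λ m → L j ≤ L m) (ℕ.m∸n+n≡m j≤k) (up (k ∸ j))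
      where
      up : ∀ e → L j ≤ L (e + j)
      up zero    = ℕ.≤-refl
      up (suc e) = ℕ.≤-trans (up e) (L-step (e + j))

    private
      cover₀ = cover (1 + n⟨ 0 ⟩)
      cover₊ : ∀ k z → _
      cover₊ k z = relative-cover n⟨ k ⟩ (1 + n⟨ suc k ⟩) z

    centre₀ : Fin (proj₁ cover₀) → Carrier
    centre₀ = proj₁ (proj₂ (proj₂ cover₀))

    centre₊ : ∀ k z → Fin (proj₁ (cover₊ k z)) → Carrier
    centre₊ k z i = proj₁ (proj₁ (proj₂ (proj₂ (cover₊ k z))) i)

    -- A relation, since the index read from the bits may exceed the number of centres.
    -- Propositional equality is used because the next cover depends on the centre itself.
    Centre : ℕ → (ℕ → Bool) → Carrier → Set
    Centre zero    u y = ∃[ i ] (toℕ i ≡ index (L 0) u × y ≡ centre₀ i)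
    Centre (suc k) u y = ∃[ z ] (Centre k u z ×
      (∃[ i ] (toℕ i ≡ index (block k) (λ j → u (L k + j)) × y ≡ centre₊ k z i)))

    Centre-unique : ∀ k {u y y′} → Centre k u y → Centre k u y′ → y ≡ y′
    Centre-unique zero (i , e , refl) (i′ , e′ , refl) = cong centre₀ (Fin.toℕ-injective (trans e (sym e′)))
    Centre-unique (suc k) (z , cz , i , e , refl) (z′ , cz′ , i′ , e′ , refl) with Centre-unique k cz cz′
    ... | refl = cong (centre₊ k z) (Fin.toℕ-injective (trans e (sym e′)))

    Centre-local : ∀ k {u v y} → Agree (L k) u v → Centre k u y → Centre k v y
    Centre-local zero    a (i , e , p) = i , trans e (index-cong (L 0) a) , p
    Centre-local (suc k) a (z , cz , i , e , p) =
      z , Centre-local k (Agree-weaken (L-step k) a) cz , i , trans e (index-cong (block k) block-agree) , p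
      where
      block-agree : Agree (block k) _ _
      block-agree j l = a (L k + j) (subst (L k + j <_) (sym (L-suc k)) (ℕ.+-monoʳ-< (L k) l))

    record Near (r k : ℕ) (u : ℕ → Bool) (x : Carrier) : Set where
      constructor near
      field
        centre   : Carrier
        isCentre : Centre k u centre
        close    : d centre x ≤ℝ 2^- r

    -- `Cell` is the tolerance demanded of names, `Core` the covering radius, which optimal centres
    -- achieve.
    Cell Core : ℕ → (ℕ → Bool) → Carrier → Set
    Cell k = Near n⟨ k ⟩ k
    Core k = Near (1 + n⟨ k ⟩) k

    Near-local : ∀ {r} k {u v x} → Agree (L k) u v → Near r k u x → Near r k v x
    Near-local k a (near y cy h) = near y (Centre-local k a cy) h

    Core⇒Cell : ∀ k {u x x′} → Core k u x → d x x′ ≤ℝ 2^- (1 + n⟨ k ⟩) → Cell k u x′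
    Core⇒Cell k {u} {x} {x′} (near y cy h) l = near y cy (d-triangle n⟨ k ⟩ y x x′ h l)

    -- Two radii 2^-n_k add up to 2^-(n_k - 1), whence the strict inequality.
    Cell-diameter : ∀ k {n u x x′} → n < n⟨ k ⟩ → Cell k u x → Cell k u x′ → d x x′ ≤ℝ 2^- n
    Cell-diameter k {n} {u} {x} {x′} n<nk (near y cy h) (near y′ cy′ h′) with Centre-unique k cy cy′
    ... | refl = d-triangle n x y x′ (d-weaken n<nk x y (d-sym y x n⟨ k ⟩ h)) (d-weaken n<nk y x′ h′)

    -- Existence of names

    abstract

      start : ∀ x → ∃[ u ] Core 0 u x
      start x with proj₂ (proj₂ (proj₂ cover₀)) x
      ... | i , h = digits (toℕ i) , near (centre₀ i) (i , sym (index-digits (L 0) (toℕ i) i<2^L₀) , refl) h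
        where
        i<2^L₀ : toℕ i < 2 ^ L 0
        i<2^L₀ = ℕ.<-≤-trans (Fin.toℕ<n i)
          (subst (λ b → proj₁ cover₀ ≤ 2 ^ b) (sym (ℕ.+-identityʳ (η (1 + n⟨ 0 ⟩)))) (proj₁ (proj₂ cover₀)))

      -- The loose tolerance is exactly membership in the ball that block k + 1 covers, and the new
      -- centre is optimal again, so errors do not accumulate.
      step : ∀ k u x → Cell k u x → ∃[ v ] (Agree (L k) u v × Core (suc k) v x)
      step k u x (near z cz h) with proj₂ (proj₂ (proj₂ (cover₊ k z))) (x , h)
      ... | i , l = v , splice-below (L k) u w
        , near (centre₊ k z i) (z , Centre-local k (splice-below (L k) u w) cz , i , code , refl) l
        where
        w v : ℕ → Bool
        w = digits (toℕ i)
        v = splice (L k) u w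
        code : toℕ i ≡ index (block k) (λ j → v (L k + j))
        code = sym (trans (index-cong (block k) (λ j _ → splice-above (L k) u w j))
          (index-digits (block k) (toℕ i) (ℕ.<-≤-trans (Fin.toℕ<n i) (proj₁ (proj₂ (cover₊ k z))))))

      continue : ∀ K u x → Cell K u x → ∃[ w ] (Agree (L K) u w × (∀ k → K < k → Core k w x))
      continue K u x cell = w , proj₁ (proj₂ chain) , core
        where
        Stage : ℕ → (ℕ → Bool) → Set
        -- Only the loose tolerance is available at the start, because u may be an optimal prefix
        -- for a different, nearby point.
        Stage zero    v = Cell K v x
        Stage (suc j) v = Core (suc j + K) v x
        Stage⇒Cell : ∀ j v → Stage j v → Cell (j + K) v x
        Stage⇒Cell zero    v s = s
        Stage⇒Cell (suc j) v s = Core⇒Cell (suc j + K) s (d-refl x (1 + n⟨ suc j + K ⟩))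
        next : ∀ j v → Stage j v → ∃[ v′ ] (Agree (L (j + K)) v v′ × Stage (suc j) v′)
        next j v s = step (j + K) v x (Stage⇒Cell j v s)
        chain : ∃[ w ] (Agree (L K) u w × (∀ j → ∃[ v ] (Stage j v × Agree (L (j + K)) v w)))
        chain = dependent-limit (λ j → L (j + K)) (λ j → L-step (j + K)) Stage next u cell
        w : ℕ → Bool
        w = proj₁ chain
        core-at : ∀ j → Core (suc j + K) w x
        core-at j = let v , c , b = proj₂ (proj₂ chain) (suc j) in Near-local (suc j + K) b c
        core : ∀ k → K < k → Core k w x
        core k K<k = subst (λ m → Core m w x) (trans (sym (ℕ.+-suc (k ∸ suc K) K)) (ℕ.m∸n+n≡m K<k)) (core-at (k ∸ suc K))

      name : ∀ x → ∃[ w ] (∀ k → Core k w x)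
      name x = w , core
        where
        u : ℕ → Bool
        u = proj₁ (start x)
        core₀ : Core 0 u x
        core₀ = proj₂ (start x)
        continuation : ∃[ w ] (Agree (L 0) u w × (∀ k → 0 < k → Core k w x))
        continuation = continue 0 u x (Core⇒Cell 0 core₀ (d-refl x (1 + n⟨ 0 ⟩)))
        w : ℕ → Bool
        w = proj₁ continuation
        core : ∀ k → Core k w x
        core zero    = Near-local 0 (proj₁ (proj₂ continuation)) core₀
        core (suc k) = proj₂ (proj₂ continuation) (suc k) z<s

      -- Every point has a name with optimal centres, so the centres coded by prefixes of `L k` bits
      -- cover X with radius 2^-(1+n_k).
      η≤L : ∀ k → η (1 + n⟨ k ⟩) ≤ L k
      η≤L k = η-least (1 + n⟨ k ⟩) (L k) λ x₀ → c x₀ , λ x → covered x₀ x (proj₂ (name x) k)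
        where
        c : Carrier → Fin (2 ^ L k) → Carrier
        c x₀ i with em {∃ (Centre k (digits (toℕ i)))}
        ... | yes (y , _) = y
        -- Prefixes that code no centre are given an arbitrary point.
        ... | no  _       = x₀
        c-centre : ∀ x₀ i {y} → Centre k (digits (toℕ i)) y → y ≡ c x₀ i
        c-centre x₀ i {y} cy with em {∃ (Centre k (digits (toℕ i)))}
        ... | yes (y′ , cy′) = Centre-unique k cy cy′
        ... | no  none       = contradiction (y , cy) none
        covered : ∀ x₀ x {w} → Core k w x → ∃[ i ] closedBall X (c x₀ i) (1 + n⟨ k ⟩) x
        covered x₀ x {w} (near y cy h) = i , subst (λ y → d y x ≤ℝ 2^- (1 + n⟨ k ⟩)) (c-centre x₀ i cy′) h
          where
          i : Fin (2 ^ L k)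
          i = fromℕ< (index<2^ (L k) w)
          cy′ : Centre k (digits (toℕ i)) y
          cy′ = subst (λ m → Centre k (digits m) y) (sym (Fin.toℕ-fromℕ< (index<2^ (L k) w)))
                  (Centre-local k (Agree-sym (digits-index (L k) w)) cy)

    -- The map from names to points and its modulus

    names-determine : ∀ {u x x′} → (∀ k → Cell k u x) → (∀ k → Cell k u x′) → x ≈ x′
    names-determine {u} {x} {x′} p q =
      separated x x′ λ n → Cell-diameter (suc n) (k≤n⟨k⟩ (suc n)) (p (suc n)) (q (suc n))

    -- The named point is the witness of membership in the domain; different witnesses for one
    -- sequence are identified by `names-determine`.
    ξ-partial : PartialMap X
    ξ-partial = record
      { dom      = λ u → ∃[ x ] (∀ k → Cell k u x)
      ; dom-resp = λ e (x , p) → x , λ k → Near-local k (λ i _ → e i) (p k)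
      ; map      = record
        { to   = λ (u , x , p) → x
        ; cong = λ { {u , x , p} {v , y , q} e →
            names-determine p (λ k → Near-local k (λ i _ → sym (e i)) (q k)) }
        }
      }

    ξ : Representation X
    ξ = record
      { partialMap = ξ-partial
      ; surjective = λ x → let w , core = name x in
          (w , x , λ k → Core⇒Cell k (core k) (d-refl x (1 + n⟨ k ⟩)))
        , λ { {v , y , q} e → names-determine q
                (λ k → Core⇒Cell k (Near-local k (λ i _ → sym (e i)) (core k)) (d-refl x (1 + n⟨ k ⟩))) }
      }

    open PartialMap ξ-partial using () renaming (Dom to Domξ; map to ξ-map; to to ξ-to)

    -- x keeps an optimal name w. Up to block K its centres are within tolerance for x′ as well;
    -- from there on x′ gets its own optimal centres.
    common-prefix : ∀ K x x′ → d x x′ ≤ℝ 2^- (1 + n⟨ K ⟩) →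
      ∃[ u ] ∃[ u′ ] (ξ-to u ≡ x × ξ-to u′ ≡ x′ × Agree (L K) (proj₁ u) (proj₁ u′))
    common-prefix K x x′ h = (w , x , λ k → Core⇒Cell k (core k) (d-refl x (1 + n⟨ k ⟩)))
                           , (w′ , x′ , cell′) , refl , refl , a
      where
      w : ℕ → Bool
      w = proj₁ (name x)
      core : ∀ k → Core k w x
      core = proj₂ (name x)
      cell-below : ∀ {k} → k ≤ K → Cell k w x′
      cell-below {k} k≤K = Core⇒Cell k (core k) (d-weaken (s≤s (n-mono k≤K)) x x′ h)
      continuation : ∃[ w′ ] (Agree (L K) w w′ × (∀ k → K < k → Core k w′ x′))
      continuation = continue K w x′ (cell-below ℕ.≤-refl)
      w′ : ℕ → Bool
      w′ = proj₁ continuation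
      a : Agree (L K) w w′
      a = proj₁ (proj₂ continuation)
      cell′ : ∀ k → Cell k w′ x′
      cell′ k = [ (λ k≤K → Near-local k (Agree-weaken (L-mono k≤K) a) (cell-below k≤K))
                , (λ K<k → Core⇒Cell k (proj₂ (proj₂ continuation) k K<k) (d-refl x′ (1 + n⟨ k ⟩)))
                ]′ (ℕ.≤-<-connex k K)

    level : ∀ n → ∃[ K ] (PreviousBelow n⟨_⟩ K n × n ≤ n⟨ K ⟩)
    level n = let K , n≤nK , minimal = least {λ K → n ≤ n⟨ K ⟩} (n , k≤n⟨k⟩ n) in K , below K minimal , n≤nK
      where
      below : ∀ K → (∀ k → n ≤ n⟨ k ⟩ → K ≤ k) → PreviousBelow n⟨_⟩ K n
      below zero    _       = _
      below (suc K) minimal = ℕ.≰⇒> λ n≤nK → ℕ.<-irrefl refl (minimal K n≤nK)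

    -- Names agreeing on `L (suc K)` bits put both points into one cell of level K + 1, and n ≤ n_K
    -- < n_{K+1} makes its diameter small enough.
    block-modulus : ∀ {μ} → IsBlockModulus η ηᵣ n⟨_⟩ μ → IsModulus Domξ X ξ-map μ
    block-modulus {μ} μ-block = μ-mono , λ { n (u , x , p) (v , y , q) → modulus n u v x y p q }
      where
      μ≡L : ∀ n → μ n ≡ L (suc (proj₁ (level n)))
      μ≡L n = let K , below , n≤nK = level n in μ-block K n below n≤nK
      level-mono : ∀ {m n} → m ≤ n → proj₁ (level m) ≤ proj₁ (level n)
      level-mono {m} {n} m≤n = proj₂ (proj₂ (least {λ K → m ≤ n⟨ K ⟩} (m , k≤n⟨k⟩ m))) (proj₁ (level n))
                                 (ℕ.≤-trans m≤n (proj₂ (proj₂ (level n))))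
      μ-mono : ∀ m n → m ≤ n → μ m ≤ μ n
      μ-mono m n m≤n = ℕ.≤-trans (ℕ.≤-reflexive (μ≡L m))
        (ℕ.≤-trans (L-mono (s≤s (level-mono m≤n))) (ℕ.≤-reflexive (sym (μ≡L n))))
      modulus : ∀ n u v x y → (∀ k → Cell k u x) → (∀ k → Cell k v y) → D u v ≤ℝ 2^- μ n → d x y ≤ℝ 2^- n
      modulus n u v x y p q h =
        Cell-diameter (suc K) (ℕ.≤-<-trans (proj₂ (proj₂ (level n))) (n-increasing K)) (p (suc K))
          (Near-local (suc K) (Agree-sym agree) (q (suc K)))
        where
        K = proj₁ (level n)
        agree : Agree (L (suc K)) u v
        agree = subst (λ l → Agree l u v) (μ≡L n) (D≤⇒Agree (μ n) u v h)

    -- Reduction of an arbitrary partial map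

    module Reduce (ξ′ : PartialMap X) (μ′ : ℕ → ℕ)
                  (μ′-modulus : IsModulus (PartialMap.Dom ξ′) X (PartialMap.map ξ′) μ′) where
      open PartialMap ξ′ using (to) renaming (Dom to Dom′)
      open MetricSpace Dom′ using () renaming (Carrier to Name′)

      m⟨_⟩ : ℕ → ℕ
      m⟨ k ⟩ = μ′ (1 + n⟨ k ⟩)

      m-step : ∀ k → m⟨ k ⟩ ≤ m⟨ suc k ⟩
      m-step k = proj₁ μ′-modulus _ _ (s≤s (ℕ.<⇒≤ (n-increasing k)))

      -- The representative of a prefix is chosen from its index, a number, so that sequences sharing the
      -- prefix get propositionally equal representatives.
      Extension : ℕ → ℕ → Set
      Extension m i = ∃ λ (v : Name′) → Agree m (digits i) (proj₁ v)

      extension : ∀ k (u : Name′) → Extension m⟨ k ⟩ (index m⟨ k ⟩ (proj₁ u))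
      extension k u = canonical (u , digits-index m⟨ k ⟩ (proj₁ u))

      rep : ℕ → Name′ → Name′
      rep k u = proj₁ (extension k u)

      rep-agree : ∀ k u → Agree m⟨ k ⟩ (proj₁ u) (proj₁ (rep k u))
      rep-agree k u = Agree-trans (Agree-sym (digits-index m⟨ k ⟩ (proj₁ u))) (proj₂ (extension k u))

      rep-local : ∀ k {u v} → Agree m⟨ k ⟩ (proj₁ u) (proj₁ v) → rep k u ≡ rep k v
      rep-local k a = canonical-extension (index-cong m⟨ k ⟩ a) _ _
        where
        canonical-extension : ∀ {m i i′} → i ≡ i′ → (e : Extension m i) (e′ : Extension m i′) →
                              proj₁ (canonical e) ≡ proj₁ (canonical e′)
        canonical-extension refl e e′ = cong proj₁ (canonical-const e e′)

      rep-close : ∀ k u → d (to (rep k u)) (to u) ≤ℝ 2^- (1 + n⟨ k ⟩)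
      rep-close k u = proj₂ μ′-modulus (1 + n⟨ k ⟩) (rep k u) u
        (Agree⇒D≤ m⟨ k ⟩ (proj₁ (rep k u)) (proj₁ u) (Agree-sym (rep-agree k u)))

      -- Stage k + 1 is built from the representative r alone, including the earlier blocks that it
      -- extends, so its locality is a mere congruence. Its last centre is optimal for the value at
      -- r, hence within tolerance for the value at u.
      stage : ℕ → Name′ → ℕ → Bool
      stage-cell : ∀ k u → Cell k (stage k u) (to u)
      next : ∀ k r → ∃[ v ] (Agree (L k) (stage k r) v × Core (suc k) v (to r))

      stage zero    u = proj₁ (start (to (rep 0 u)))
      stage (suc k) u = proj₁ (next k (rep (suc k) u))

      stage-cell zero    u = Core⇒Cell 0 (proj₂ (start (to (rep 0 u)))) (rep-close 0 u)
      stage-cell (suc k) u = Core⇒Cell (suc k) (proj₂ (proj₂ (next k (rep (suc k) u)))) (rep-close (suc k) u)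

      next k r = step k (stage k r) (to r) (stage-cell k r)

      stage-local : ∀ k {u v} → Agree m⟨ k ⟩ (proj₁ u) (proj₁ v) → stage k u ≡ stage k v
      stage-local zero    {u} {v} a = cong (λ r → proj₁ (start (to r))) (rep-local 0 {u} {v} a)
      stage-local (suc k) {u} {v} a = cong (λ r → proj₁ (next k r)) (rep-local (suc k) {u} {v} a)

      -- Stage k + 1 extends stage k of r rather than of u; the two coincide because r and u share
      -- `m⟨ suc k ⟩` digits, at least `m⟨ k ⟩`.
      stage-step : ∀ u k → Agree (L k) (stage k u) (stage (suc k) u)
      stage-step u k = subst (λ w → Agree (L k) w (stage (suc k) u))
        (sym (stage-local k {u} {r} (Agree-weaken (m-step k) (rep-agree (suc k) u))))
        (proj₁ (proj₂ (next k r)))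
        where r = rep (suc k) u

      code : Name′ → ℕ → Bool
      code u = limit L (λ k → stage k u)

      code-agree : ∀ u k → Agree (L k) (stage k u) (code u)
      code-agree u = limit-agree L L-step (λ k → stage k u) (stage-step u)

      code-local : ∀ k {u v} → Agree m⟨ k ⟩ (proj₁ u) (proj₁ v) → Agree (L k) (code u) (code v)
      code-local k {u} {v} a = Agree-trans (Agree-sym (code-agree u k))
        (subst (λ w → Agree (L k) w (code v)) (sym (stage-local k {u} {v} a)) (code-agree v k))

      -- Qualitative continuity at every digit, also beyond all `L k` when these are bounded; there
      -- the digit is constant.
      digit-local : ∀ j → ∃[ k ] (∀ u v → Agree k (proj₁ u) (proj₁ v) → code u j ≡ code v j)
      digit-local j with limit-digit L j
      ... | inj₁ (k , e) = m⟨ k ⟩ , λ u v a →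
        trans (e (λ k → stage k u)) (trans (cong (λ w → w j) (stage-local k {u} {v} a)) (sym (e (λ k → stage k v))))
      ... | inj₂ e       = 0 , λ u v _ → trans (e (λ k → stage k u)) (sym (e (λ k → stage k v)))

      prefix-local : ∀ n → ∃[ k ] (∀ u v → Agree k (proj₁ u) (proj₁ v) → Agree n (code u) (code v))
      prefix-local zero    = 0 , λ _ _ _ _ ()
      prefix-local (suc n) with prefix-local n | digit-local n
      ... | k , p | k′ , q = k ⊔ k′ , λ u v a i i<1+n → at u v a i (ℕ.m<1+n⇒m<n∨m≡n i<1+n)
        where
        at : ∀ u v → Agree (k ⊔ k′) (proj₁ u) (proj₁ v) → ∀ i → i < n ⊎ i ≡ n → code u i ≡ code v i
        at u v a i (inj₁ i<n) = p u v (Agree-weaken (ℕ.m≤m⊔n k k′) a) i i<n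
        at u v a i (inj₂ refl) = q u v (Agree-weaken (ℕ.m≤n⊔m k k′) a)

      G : Map Dom′ Domξ
      G = record
        { to   = λ u → code u , to u , λ k → Near-local k (code-agree u k) (stage-cell k u)
        ; cong = λ {u} {v} e j → proj₂ (digit-local j) u v (λ i _ → e i)
        }

      modulus-at : ∀ n k → (∀ u v → Agree k (proj₁ u) (proj₁ v) → Agree n (code u) (code v)) →
                   ModulusAt Dom′ Domξ G n k
      modulus-at n k loc u v h = Agree⇒D≤ n (code u) (code v) (loc u v (D≤⇒Agree k (proj₁ u) (proj₁ v) h))

      -- `prefix-local` makes some modulus exist; pointwise minimality then turns `code-local` into
      -- the bound at the lengths `L k`.
      G-modulus : ∃[ ν ] (IsModulus Dom′ Domξ G ν × (∀ k → ν (L k) ≤ μ′ (1 + n⟨ k ⟩)))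
      G-modulus =
        let ν , ν-modulus , ν-min = least-modulus Dom′ Domξ G
              (λ n → proj₁ (prefix-local n) , modulus-at n (proj₁ (prefix-local n)) (proj₂ (prefix-local n)))
        in ν , ν-modulus , λ k → ν-min (L k) m⟨ k ⟩ (modulus-at (L k) m⟨ k ⟩ (λ u v → code-local k {u} {v}))

    -- Standardness for a class of growth bounds

    module Standard (bound : ℕ → ℕ → ℕ) (Admissible : Pred (ℕ → ℕ) 0ℓ)
      (bound-mono : ∀ c {m n} → m ≤ n → bound c m ≤ bound c n)
      (bound-admissible : ∀ c → Admissible (bound c))
      (bound-closed : ∀ c a → ∃[ c′ ] (∀ n → 1 + a + bound c n + bound c (a + bound c n) ≤ bound c′ n))
      {μ : ℕ → ℕ} (μ-block : IsBlockModulus η ηᵣ n⟨_⟩ μ)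
      (c : ℕ) (n-growth : ∀ k → n⟨ suc k ⟩ ≤ bound c n⟨ k ⟩) (μ-growth : ∀ K → μ n⟨ K ⟩ ≤ η (bound c n⟨ K ⟩)) where

      private
        c′ : ℕ
        c′ = proj₁ (bound-closed c n⟨ 0 ⟩)

        -- With K the level of n, this majorises 1 + n_K for (3), `bound c n⟨ K ⟩` for (1), and 1 +
        -- n_{K+1} for (2′), so one constant c′ serves all three conditions.
        total : ℕ → ℕ
        total n = 1 + n⟨ 0 ⟩ + bound c n + bound c (n⟨ 0 ⟩ + bound c n)

        total-bound : ∀ n → total n ≤ bound c′ n
        total-bound = proj₂ (bound-closed c n⟨ 0 ⟩)

        K⟨_⟩ : ℕ → ℕ
        K⟨ n ⟩ = proj₁ (level n)

        n≤nK : ∀ n → n ≤ n⟨ K⟨ n ⟩ ⟩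
        n≤nK n = proj₂ (proj₂ (level n))

        -- For positive K the growth condition applies to n_{K-1} < n; the summand n_0 accounts for
        -- K = 0.
        nK-bound : ∀ n → n⟨ K⟨ n ⟩ ⟩ ≤ n⟨ 0 ⟩ + bound c n
        nK-bound n = at K⟨ n ⟩ (proj₁ (proj₂ (level n)))
          where
          at : ∀ K → PreviousBelow n⟨_⟩ K n → n⟨ K ⟩ ≤ n⟨ 0 ⟩ + bound c n
          at zero    _ = ℕ.m≤m+n n⟨ 0 ⟩ (bound c n)
          at (suc K) p = ℕ.≤-trans (n-growth K)
            (ℕ.≤-trans (bound-mono c (ℕ.<⇒≤ p)) (ℕ.m≤n+m (bound c n) n⟨ 0 ⟩))

        1+nK-bound : ∀ n → 1 + n⟨ K⟨ n ⟩ ⟩ ≤ bound c′ n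
        1+nK-bound n = ℕ.≤-trans (s≤s (nK-bound n)) (ℕ.≤-trans (ℕ.m≤m+n _ _) (total-bound n))

        bound-nK-bound : ∀ n → 1 + bound c n⟨ K⟨ n ⟩ ⟩ ≤ bound c′ n
        bound-nK-bound n = ℕ.≤-trans (s≤s (bound-mono c (nK-bound n)))
          (ℕ.≤-trans (s≤s (ℕ.m≤n+m _ (n⟨ 0 ⟩ + bound c n))) (total-bound n))

        μ≡L : ∀ n → μ n ≡ L (suc K⟨ n ⟩)
        μ≡L n = μ-block K⟨ n ⟩ n (proj₁ (proj₂ (level n))) (n≤nK n)

        μ-bound : ∀ n → μ n ≤ η (bound c′ n)
        μ-bound n = ℕ.≤-trans (proj₁ (block-modulus μ-block) n n⟨ K⟨ n ⟩ ⟩ (n≤nK n))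
          (ℕ.≤-trans (μ-growth K⟨ n ⟩) (η-mono (ℕ.≤-trans (ℕ.n≤1+n _) (bound-nK-bound n))))

        minimal-ξ : ∃ (IsMinimalModulus Domξ X ξ-map)
        minimal-ξ = minimal-modulus Domξ X ξ-map (μ , block-modulus μ-block)

        μξ : ℕ → ℕ
        μξ = proj₁ minimal-ξ

        μξ≤μ : ∀ n → μξ n ≤ μ n
        μξ≤μ = proj₂ (proj₂ minimal-ξ) μ (block-modulus μ-block)

      reduction : (ξ′ : PartialMap X) → ∃ (IsModulus (PartialMap.Dom ξ′) X (PartialMap.map ξ′)) →
                  Reduction bound ξ′ ξ-partial
      reduction ξ′ mod′ =
          μξ , μ′ , proj₂ minimal-ξ , proj₂ minimal-ξ′ , G , ν , ν-modulus
        , (λ u → IsGeneralMetric.EqC.refl isMetric)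
        -- `μξ n` is at most `μ n`, which is `L (suc K)`, and at this length ν is at most
        -- `μ′ (1 + n⟨ suc K ⟩)`.
        , c′ , λ n → ℕ.≤-trans (proj₁ ν-modulus _ _ (ℕ.≤-trans (μξ≤μ n) (ℕ.≤-reflexive (μ≡L n))))
            (ℕ.≤-trans (ν-bound (suc K⟨ n ⟩))
              (proj₁ μ′-modulus _ _ (ℕ.≤-trans (s≤s (n-growth K⟨ n ⟩)) (bound-nK-bound n))))
        where
        minimal-ξ′ : ∃ (IsMinimalModulus (PartialMap.Dom ξ′) X (PartialMap.map ξ′))
        minimal-ξ′ = minimal-modulus (PartialMap.Dom ξ′) X (PartialMap.map ξ′) mod′
        μ′ : ℕ → ℕ
        μ′ = proj₁ minimal-ξ′
        μ′-modulus : IsModulus (PartialMap.Dom ξ′) X (PartialMap.map ξ′) μ′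
        μ′-modulus = proj₁ (proj₂ minimal-ξ′)
        open Reduce ξ′ μ′ μ′-modulus using (G; G-modulus)
        ν : ℕ → ℕ
        ν = proj₁ G-modulus
        ν-modulus : IsModulus (PartialMap.Dom ξ′) Domξ G ν
        ν-modulus = proj₁ (proj₂ G-modulus)
        ν-bound : ∀ k → ν (L k) ≤ μ′ (1 + n⟨ k ⟩)
        ν-bound = proj₂ (proj₂ G-modulus)

      close⇒names-close : ∀ n x x′ → d x x′ ≤ℝ 2^- bound c′ n →
                          ∃[ r ] (IsInducedDistance ξ-partial x x′ r × r ≤ℝ 2^- η n)
      close⇒names-close n x x′ h =
        let K = K⟨ n ⟩
            u , u′ , ux , u′x′ , a = common-prefix K x x′ (d-weaken (1+nK-bound n) x x′ h)
            p = IsGeneralMetric.EqC.reflexive isMetric ux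
            p′ = IsGeneralMetric.EqC.reflexive isMetric u′x′
            r , isDistance = induced-distance x x′ (u , p) (u′ , p′)
            -- n ≤ n_K < 1 + n_K, and `L K` is at least the entropy at 1 + n_K.
            ηn≤L = ℕ.≤-trans (η-mono (ℕ.m≤n⇒m≤1+n (n≤nK n))) (η≤L K)
        in r , isDistance , induced-distance-≤ x x′ r isDistance u u′ p p′ (η n) (Agree-weaken ηn≤L a)
        where open InducedDistance X ξ-partial μ (block-modulus μ-block)

      isStandard : IsStandard η ξ bound Admissible
      isStandard =
          (μξ , proj₂ minimal-ξ , c′ , λ n → ℕ.≤-trans (μξ≤μ n) (μ-bound n))
        , reduction
        , bound c′ , bound-admissible c′ , close⇒names-close

-- Growth bounds

linear-mono : ∀ c {m n} → m ≤ n → linear c m ≤ linear c n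
linear-mono c m≤n = ℕ.+-monoʳ-≤ c (ℕ.*-monoʳ-≤ c m≤n)

polynomial-mono : ∀ c {m n} → m ≤ n → polynomial c m ≤ polynomial c n
polynomial-mono c m≤n = ℕ.+-monoʳ-≤ c (ℕ.*-monoʳ-≤ c (ℕ.^-monoˡ-≤ c m≤n))

linear-closed : ∀ c a → ∃[ c′ ] (∀ n → 1 + a + linear c n + linear c (a + linear c n) ≤ linear c′ n)
-- The same number must serve as constant term and as slope.
linear-closed c a = α + β , λ n → begin
  1 + a + linear c n + linear c (a + linear c n) ≡⟨ expand c a n ⟩
  α + β * n                                      ≤⟨ ℕ.+-mono-≤ (ℕ.m≤m+n α β) (ℕ.*-monoˡ-≤ n (ℕ.m≤n+m β α)) ⟩
  linear (α + β) n                               ∎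
  where
  open ℕ.≤-Reasoning
  α = 1 + a + c + c + c * (a + c)
  β = c + c * c
  expand : ∀ c a n → 1 + a + (c + c * n) + (c + c * (a + (c + c * n))) ≡
                     1 + a + c + c + c * (a + c) + (c + c * c) * n
  expand = solve-∀

^-distribʳ-* : ∀ k m n → (m * n) ^ k ≡ m ^ k * n ^ k
^-distribʳ-* zero    m n = refl
^-distribʳ-* (suc k) m n = trans (cong (m * n *_) (^-distribʳ-* k m n)) (ℕ.[m*n]*[o*p]≡[m*o]*[n*p] m n (m ^ k) (n ^ k))

polynomial-closed : ∀ c a → ∃[ c′ ] (∀ n → 1 + a + polynomial c n + polynomial c (a + polynomial c n) ≤ polynomial c′ n)
polynomial-closed c a = A + E , bounded
  where
  open ℕ.≤-Reasoning
  -- b bounds the inner polynomial by b n^c, A adds up all coefficients, and E dominates both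
  -- exponents c and c · c.
  b = a + (c + c)
  A = 1 + b + (c + c * b ^ c)
  E = c + c * c

  -- For n ≥ 1 everything is at most A nᴱ.
  positive : ∀ n .{{_ : NonZero n}} → 1 + a + polynomial c n + polynomial c (a + polynomial c n) ≤ A * n ^ E
  positive n = begin
    1 + a + polynomial c n + polynomial c (a + polynomial c n)
      ≤⟨ ℕ.+-mono-≤ (s≤s inner) (polynomial-mono c inner) ⟩
    1 + b * n ^ c + (c + c * (b * n ^ c) ^ c)
      ≡⟨ cong (λ p → 1 + b * n ^ c + (c + c * p)) (^-distribʳ-* c b (n ^ c)) ⟩
    1 + b * n ^ c + (c + c * (b ^ c * (n ^ c) ^ c))
      ≡⟨ cong (λ p → 1 + b * n ^ c + (c + c * (b ^ c * p))) (ℕ.^-*-assoc n c c) ⟩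
    1 + b * n ^ c + (c + c * (b ^ c * n ^ (c * c)))
      ≤⟨ ℕ.+-mono-≤ (ℕ.+-mono-≤ (ℕ.m^n>0 n E) (ℕ.*-monoʳ-≤ b (ℕ.^-monoʳ-≤ n (ℕ.m≤m+n c (c * c)))))
           (ℕ.+-mono-≤ (ℕ.m≤m*n c (n ^ E) {{ℕ.m^n≢0 n E}})
             (ℕ.*-monoʳ-≤ c (ℕ.*-monoʳ-≤ (b ^ c) (ℕ.^-monoʳ-≤ n (ℕ.m≤n+m (c * c) c))))) ⟩
    n ^ E + b * n ^ E + (c * n ^ E + c * (b ^ c * n ^ E))
      ≡⟨ collect (n ^ E) b c (b ^ c) ⟩
    A * n ^ E ∎
    where
    collect : ∀ x b c y → x + b * x + (c * x + c * (y * x)) ≡ (1 + b + (c + c * y)) * x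
    collect = solve-∀
    regroup : ∀ a c x → a * x + (c * x + c * x) ≡ (a + (c + c)) * x
    regroup = solve-∀
    inner : a + polynomial c n ≤ b * n ^ c
    inner = begin
      a + (c + c * n ^ c)                       ≤⟨ ℕ.+-mono-≤ (ℕ.m≤m*n a (n ^ c)) (ℕ.+-monoˡ-≤ _ (ℕ.m≤m*n c (n ^ c))) ⟩
      a * n ^ c + (c * n ^ c + c * n ^ c)       ≡⟨ regroup a c (n ^ c) ⟩
      b * n ^ c                                 ∎
      where instance _ = ℕ.m^n≢0 n c

  bounded : ∀ n → 1 + a + polynomial c n + polynomial c (a + polynomial c n) ≤ polynomial (A + E) n
  -- The bound A n^E may fail at 0; monotonicity reduces to n = 1, where it equals A and fits into
  -- the constant term.
  bounded zero = begin
    1 + a + polynomial c 0 + polynomial c (a + polynomial c 0)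
      ≤⟨ ℕ.+-mono-≤ (ℕ.+-monoʳ-≤ (1 + a) (polynomial-mono c z≤n))
           (polynomial-mono c (ℕ.+-monoʳ-≤ a (polynomial-mono c {0} {1} z≤n))) ⟩
    1 + a + polynomial c 1 + polynomial c (a + polynomial c 1) ≤⟨ positive 1 ⟩
    A * 1 ^ E                                                  ≡⟨ trans (cong (A *_) (ℕ.^-zeroˡ E)) (ℕ.*-identityʳ A) ⟩
    A                                                          ≤⟨ ℕ.m≤m+n A E ⟩
    A + E                                                      ≤⟨ ℕ.m≤m+n (A + E) _ ⟩
    polynomial (A + E) 0                                       ∎
  bounded n@(suc _) = begin
    1 + a + polynomial c n + polynomial c (a + polynomial c n) ≤⟨ positive n ⟩
    A * n ^ E             ≤⟨ ℕ.*-mono-≤ (ℕ.m≤m+n A E) (ℕ.^-monoʳ-≤ n (ℕ.m≤n+m E A)) ⟩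
    (A + E) * n ^ (A + E) ≤⟨ ℕ.m≤n+m _ (A + E) ⟩
    polynomial (A + E) n  ∎

-- In Horner form multiplying by n prepends a zero, and adding a constant changes only the head of
-- the list.
polynomial-isPolynomial : ∀ c → IsPolynomial (polynomial c)
polynomial-isPolynomial c = add-constant c (λ n → c * n ^ c) (monomial c)
  where
  horner : List ℕ → ℕ → ℕ
  horner as n = foldr (λ a r → a + n * r) 0 as
  monomial : ∀ e → Σ (List ℕ) λ as → ∀ n → c * n ^ e ≡ horner as n
  monomial zero    = c ∷ [] , λ n → trans (ℕ.*-identityʳ c) (sym (trans (cong (c +_) (ℕ.*-zeroʳ n)) (ℕ.+-identityʳ c)))
  monomial (suc e) = let as , eq = monomial e in
    0 ∷ as , λ n → trans (swap c n (n ^ e)) (cong (n *_) (eq n))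
    where
    swap : ∀ c n x → c * (n * x) ≡ n * (c * x)
    swap = solve-∀
  add-constant : ∀ b f → (Σ (List ℕ) λ as → ∀ n → f n ≡ horner as n) → IsPolynomial (λ n → b + f n)
  add-constant b f ([]     , eq) = b ∷ [] , λ n → cong (b +_) (trans (eq n) (sym (ℕ.*-zeroʳ n)))
  add-constant b f (a ∷ as , eq) = b + a ∷ as , λ n → trans (cong (b +_) (eq n)) (sym (ℕ.+-assoc b a _))

theorem24 : ExcludedMiddle 0ℓ →
    (X : MetricSpace) → IsCompact X →
    (η : ℕ → ℕ) → IsBinaryEntropy X η →
    (ηᵣ : ℕ → ℕ → ℕ) → IsRelativeBinaryEntropy X ηᵣ →
    (n⟨_⟩ : ℕ → ℕ) → (∀ k → 0 < n⟨ k ⟩) → (∀ k → n⟨ k ⟩ < n⟨ suc k ⟩) →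
    (μ : ℕ → ℕ) → IsBlockModulus η ηᵣ n⟨_⟩ μ →
    ((∃[ c ] ((∀ k → n⟨ suc k ⟩ ≤ linear c n⟨ k ⟩) × (∀ K → μ n⟨ K ⟩ ≤ η (linear c n⟨ K ⟩)))) →
    Σ (Representation X) λ ξ → IsLinearlyStandard η ξ × IsModulus (Representation.Dom ξ) X (Representation.map ξ) μ)
    ×
    ((∃[ c ] ((∀ k → n⟨ suc k ⟩ ≤ polynomial c n⟨ k ⟩) × (∀ K → μ n⟨ K ⟩ ≤ η (polynomial c n⟨ K ⟩)))) →
    Σ (Representation X) λ ξ → IsPolynomiallyStandard η ξ × IsModulus (Representation.Dom ξ) X (Representation.map ξ) μ)
theorem24 em X _ η η-entropy ηᵣ ηᵣ-entropy n⟨_⟩ _ n-increasing μ μ-block =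
    (λ (c , n-growth , μ-growth) → ξ
      , Standard.isStandard linear IsLinear linear-mono (λ c → c , λ _ → refl) linear-closed
          μ-block c n-growth μ-growth
      , block-modulus μ-block)
  , (λ (c , n-growth , μ-growth) → ξ
      , Standard.isStandard polynomial IsPolynomial polynomial-mono polynomial-isPolynomial polynomial-closed
          μ-block c n-growth μ-growth
      , block-modulus μ-block)
  where
  open Classical em
  open Coding X η η-entropy ηᵣ ηᵣ-entropy n⟨_⟩ n-increasing
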